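{- For every integer $r\geq 2$ and every integer $n\geq 3r^2\, r!\,\log r$, $\mathrm{tp}_r(K_n)\leq r$.
   Context: $K_n$ is the complete graph on $n$ vertices and $\log$ is the natural logarithm. The $r$-color tree-partition number $\mathrm{tp}_r(G)$ of a graph $G$ is the minimum $s$ such that for every $r$-coloring of the edges of $G$ (an arbitrary assignment of one of $r$ colors to each edge) there exists a collection of monochromatic connected subgraphs $\{H_1,\dots,H_t\}$ of $G$ with $t\leq s$ such that $\{V(H_1),\dots,V(H_t)\}$ is a partition of $V(G)$. (A single vertex counts as a monochromatic connected subgraph.) -}

module Defs where

open import Algebra.Definitions.RawMonoid using (sum)
open import Data.Fin.Base using (Fin; toℕ)
open import Data.Fin.Properties using (any?; all?) renaming (_≟_ to _≟ᶠ_)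
open import Data.Fin.Subset using (Subset; Nonempty; _∈_; _⊃_; ⁅_⁆; _∪_)
open import Data.Fin.Subset.Induction using (⊃-wellFounded)
open import Data.Fin.Subset.Properties
  using (_∈?_; nonempty?; anySubset?; x∈⁅x⁆; x∈⁅y⁆⇒x≡y; x∈p∪q⁻; p⊆p∪q; q⊆p∪q)
open import Data.Integer.Base using (+_)
open import Data.Maybe.Base using (Maybe; just; nothing)
open import Data.Maybe.Properties using (just-injective; ≡-dec)
open import Data.Nat.Base using (ℕ; zero; suc; _+_; _*_; _∸_; _≤_; _<_; s≤s)
open import Data.Nat.Properties
  using (anyUpTo?; ≤-refl; ≮⇒≥; m<1+n⇒m≤n)
open import Data.Nat.Induction using (<-wellFounded)
open import Data.Product using (∃!)
open import Data.Product.Base using (Σ; ∃; ∃-syntax; _×_; _,_; proj₁; proj₂)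
open import Data.Rational.Unnormalised.Base as ℚᵘ using (ℚᵘ)
open import Data.Sum.Base using (_⊎_; inj₁; inj₂)
open import Data.Vec.Base using (Vec; []; _∷_; lookup; tabulate)
open import Data.Vec.Properties using (lookup∘tabulate)
open import Function.Base using (_∘_)
open import Induction.WellFounded using (Acc; acc)
open import Level as Level using (0ℓ)
open import Relation.Binary.Core using (Rel)
open import Relation.Binary.Definitions using (Decidable)
open import Relation.Binary.Construct.Closure.ReflexiveTransitive as Star
  using (Star; ε; _◅_; _◅◅_)
open import Relation.Binary.PropositionalEquality
  using (_≡_; _≢_; refl; sym; trans; cong; subst; ≢-sym)
open import Relation.Nullary using (Dec; yes; no; ¬_; contradiction)
open import Relation.Nullary.Decidable
  using (map′; ¬?; _×-dec_; _⊎-dec_; _→-dec_; decidable-stable)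
import Relation.Unary as U

------------------------------------------------------------------------
-- The natural logarithm

-- A sequence of rationals, standing for its supremum in ℝ.
LowerReal : Set
LowerReal = ℕ → ℚᵘ

infix  4 _≤ᴿ_
infixl 7 _·ᴿ_

-- sup x ≤ sup y
_≤ᴿ_ : LowerReal → LowerReal → Set
x ≤ᴿ y = ∀ q → (∃[ i ] q ℚᵘ.< x i) → ∃[ j ] q ℚᵘ.< y j

fromℕᴿ : ℕ → LowerReal
fromℕᴿ n _ = + n ℚᵘ./ 1

-- Multiplication by a natural number commutes with suprema.
_·ᴿ_ : ℕ → LowerReal → LowerReal
(c ·ᴿ x) i = (+ c ℚᵘ./ 1) ℚᵘ.* x i

-- For r ≥ 1, log r = ∫₁ʳ dt/t is the supremum of the lower Darboux sums for
-- the subdivisions of [1 , r] into steps of length 1/N, where N = suc k.  As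
-- 1/t is decreasing, the infimum on [1 + i/N , 1 + (i+1)/N] is attained at the
-- right endpoint, so this step contributes 1/N · 1/(1 + (i+1)/N), which is
-- 1/(N + i + 1).
log : ℕ → LowerReal
log r k = sum ℚᵘ.+-0-rawMonoid
  {(r ∸ 1) * N} (λ i → + 1 ℚᵘ./ (N + suc (toℕ i)))
  where N = suc k

------------------------------------------------------------------------
-- Graphs, colourings and monochromatic partitions

record Graph (n : ℕ) : Set₁ where
  field
    Adj        : Rel (Fin n) 0ℓ
    adj?       : Decidable Adj
    adj-sym    : ∀ {u v} → Adj u v → Adj v u
    adj-irrefl : ∀ {v} → ¬ Adj v v

K : ∀ n → Graph n
K n = record
  { Adj        = _≢_
  ; adj?       = λ u v → ¬? (u ≟ᶠ v)
  ; adj-sym    = ≢-sym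
  ; adj-irrefl = λ v≢v → v≢v refl
  }

-- colour-sym makes the colour depend only on the unordered pair {u , v}; in
-- particular it does not depend on the proof of adjacency.
record Colouring (r : ℕ) {n : ℕ} (G : Graph n) : Set where
  open Graph G
  field
    colour     : ∀ {u v} → Adj u v → Fin r
    colour-sym : ∀ {u v} (e : Adj u v) (e′ : Adj v u) → colour e ≡ colour e′

record Subgraph {n : ℕ} (G : Graph n) : Set₁ where
  open Graph G
  field
    V     : Subset n
    E     : Rel (Fin n) 0ℓ
    E-sym : ∀ {u v} → E u v → E v u
    E⊆Adj : ∀ {u v} → E u v → Adj u v
    E-end : ∀ {u v} → E u v → u ∈ V × v ∈ V

Connected : ∀ {n} {G : Graph n} → Subgraph G → Set
Connected H = Nonempty V × (∀ {u v} → u ∈ V → v ∈ V → Star E u v)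
  where open Subgraph H

Monochromatic : ∀ {r n} {G : Graph n} → Colouring r G → Subgraph G → Set
Monochromatic c H =
  ∀ {u v x y} (e : E u v) (f : E x y) → colour (E⊆Adj e) ≡ colour (E⊆Adj f)
  where open Subgraph H; open Colouring c

Partitions : ∀ {n t} {G : Graph n} → (Fin t → Subgraph G) → Set
Partitions H = ∀ v → ∃! _≡_ (λ i → v ∈ Subgraph.V (H i))

-- The parts are nonempty because connected subgraphs are.
HasTreePartition : ∀ {r n} {G : Graph n} → Colouring r G → ℕ → Set₁
HasTreePartition {G = G} c s =
  ∃[ t ] t ≤ s × Σ (Fin t → Subgraph G) λ H →
    (∀ i → Monochromatic c (H i)) × (∀ i → Connected (H i)) × Partitions H

TreePartitionable : ∀ {n} → ℕ → Graph n → ℕ → Set₁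
TreePartitionable r G s = (c : Colouring r G) → HasTreePartition c s

IsMinimum : ∀ {ℓ} → (ℕ → Set ℓ) → ℕ → Set ℓ
IsMinimum P m = P m × (∀ s → P s → m ≤ s)

------------------------------------------------------------------------
-- The minimum defining the tree-partition number exists

-- TreePartitionable r G s is decidable, because it quantifies over finitely
-- many colourings and partitions up to equivalence, and it holds for s = n.

private

  minimum : ∀ {ℓ} {P : ℕ → Set ℓ} → U.Decidable P → ∀ s → P s → ∃ (IsMinimum P)
  minimum {P = P} P? s p = go s p (<-wellFounded s)
    where
    go : ∀ s → P s → Acc _<_ s → ∃ (IsMinimum P)
    go s p (acc rs) with anyUpTo? P? s
    ... | yes (m , m<s , q) = go m q (rs m<s)
    ... | no ¬below = s , p , λ m q → ≮⇒≥ λ m<s → ¬below (m , m<s , q)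

  Exhaustible : ∀ ℓ → Set → Set (Level.suc ℓ)
  Exhaustible ℓ A = ∀ {P : A → Set ℓ} → U.Decidable P → Dec (∃ P)

  anyVec? : ∀ {ℓ A} → Exhaustible ℓ A → ∀ {m} → Exhaustible ℓ (Vec A m)
  anyVec? anyA {zero}  P? = map′ ([] ,_) (λ { ([] , p) → p }) (P? [])
  anyVec? anyA {suc m} P? =
    map′ (λ (x , xs , p) → x ∷ xs , p) (λ { (x ∷ xs , p) → x , xs , p })
      (anyA λ x → anyVec? anyA λ xs → P? (x ∷ xs))

  anyMaybe? : ∀ {ℓ A} → Exhaustible ℓ A → Exhaustible ℓ (Maybe A)
  anyMaybe? anyA P? =
    map′ (λ { (inj₁ p) → nothing , p ; (inj₂ (x , p)) → just x , p })
         (λ { (nothing , p) → inj₁ p ; (just x , p) → inj₂ (x , p) })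
      (P? nothing ⊎-dec anyA (λ x → P? (just x)))

  -- The set of vertices known to be reachable from u is enlarged until it is
  -- closed under R.
  reachable? : ∀ {n} {R : Rel (Fin n) 0ℓ} → Decidable R → Decidable (Star R)
  reachable? {n} {R} R? u v =
    go ⁅ u ⁆ (⊃-wellFounded _) (x∈⁅x⁆ u)
       (λ x∈ → subst (Star R u) (sym (x∈⁅y⁆⇒x≡y u x∈)) ε)
    where
    go : ∀ T → Acc _⊃_ T → u ∈ T → (∀ {x} → x ∈ T → Star R u x) →
         Dec (Star R u v)
    go T (acc rs) u∈T reach
      with any? (λ x → any? (λ y → x ∈? T ×-dec ¬? (y ∈? T) ×-dec R? x y))
    ... | yes (x , y , x∈T , y∉T , Rxy) =
      go (T ∪ ⁅ y ⁆)
         (rs (p⊆p∪q ⁅ y ⁆ , y , q⊆p∪q T ⁅ y ⁆ (x∈⁅x⁆ y) , y∉T))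
         (p⊆p∪q ⁅ y ⁆ u∈T) reach′
      where
      reach′ : ∀ {z} → z ∈ T ∪ ⁅ y ⁆ → Star R u z
      reach′ z∈ with x∈p∪q⁻ T ⁅ y ⁆ z∈
      ... | inj₁ z∈T = reach z∈T
      ... | inj₂ z∈y = subst (Star R u) (sym (x∈⁅y⁆⇒x≡y y z∈y))
                             (reach x∈T ◅◅ Rxy ◅ ε)
    ... | no closed = map′ reach (walk u∈T) (v ∈? T)
      where
      walk : ∀ {x z} → x ∈ T → Star R x z → z ∈ T
      walk x∈T ε = x∈T
      walk {x} x∈T (_◅_ {j = y} Rxy ys) = walk
        (decidable-stable (y ∈? T) λ y∉T → closed (x , y , x∈T , y∉T , Rxy)) ys

  module _ {r n : ℕ} {G : Graph n} (c : Colouring r G) where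
    open Graph G
    open Colouring c

    colour-irr : ∀ {u v} (e e′ : Adj u v) → colour e ≡ colour e′
    colour-irr e e′ = trans (colour-sym e (adj-sym e)) (colour-sym (adj-sym e) e′)

    Edge : Subset n → Fin r → Rel (Fin n) 0ℓ
    Edge S k u v = u ∈ S × v ∈ S × Σ (Adj u v) λ e → colour e ≡ k

    edge? : ∀ S k → Decidable (Edge S k)
    edge? S k u v = u ∈? S ×-dec v ∈? S ×-dec coloured
      where
      coloured : Dec (Σ (Adj u v) λ e → colour e ≡ k)
      coloured with adj? u v
      ... | no ¬e = no (¬e ∘ proj₁)
      ... | yes e = map′ (e ,_) (λ (e′ , q) → trans (colour-irr e e′) q)
                         (colour e ≟ᶠ k)

    -- S is the vertex set of a monochromatic connected subgraph.
    Spanned : Subset n → Set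
    Spanned S = Nonempty S ×
      ((∀ u v → u ∈ S → v ∈ S → u ≡ v) ⊎
       (∃[ k ] ∀ u v → u ∈ S → v ∈ S → Star (Edge S k) u v))

    spanned? : U.Decidable Spanned
    spanned? S = nonempty? S ×-dec
      (pairs? _≟ᶠ_ ⊎-dec any? (λ k → pairs? (reachable? (edge? S k))))
      where
      pairs? : ∀ {R : Rel (Fin n) 0ℓ} → Decidable R →
               Dec (∀ u v → u ∈ S → v ∈ S → R u v)
      pairs? R? =
        all? λ u → all? λ v → (u ∈? S) →-dec ((v ∈? S) →-dec R? u v)

    spans : ∀ H → Monochromatic c H → Connected H → Spanned (Subgraph.V H)
    spans H mono ((v₀ , v₀∈V) , conn) = (v₀ , v₀∈V) , split
      where
      open Subgraph H

      firstEdge : ∀ {u v} → u ≢ v → Star E u v → ∃[ x ] ∃[ y ] E x y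
      firstEdge u≢v ε       = contradiction refl u≢v
      firstEdge u≢v (e ◅ _) = _ , _ , e

      split : (∀ u v → u ∈ V → v ∈ V → u ≡ v) ⊎
              (∃[ k ] ∀ u v → u ∈ V → v ∈ V → Star (Edge V k) u v)
      split with any? (λ v → v ∈? V ×-dec ¬? (v₀ ≟ᶠ v))
      ... | yes (v , v∈V , v₀≢v) =
        let _ , _ , f = firstEdge v₀≢v (conn v₀∈V v∈V) in
        inj₂ (colour (E⊆Adj f) , λ _ _ x∈V y∈V →
          Star.map (λ e → proj₁ (E-end e) , proj₂ (E-end e) , E⊆Adj e , mono e f)
                   (conn x∈V y∈V))
      ... | no ¬other = inj₁ λ x y x∈V y∈V → trans (sym (≡v₀ x x∈V)) (≡v₀ y y∈V)
        where
        ≡v₀ : ∀ x → x ∈ V → v₀ ≡ x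
        ≡v₀ x x∈V =
          decidable-stable (v₀ ≟ᶠ x) λ v₀≢x → ¬other (x , x∈V , v₀≢x)

    unspan : ∀ {S} → Spanned S →
             Σ (Subgraph G) λ H →
               Subgraph.V H ≡ S × Monochromatic c H × Connected H
    unspan {S} (S≠∅ , inj₁ single) = record
      { V     = S
      ; E     = λ u v → u ∈ S × v ∈ S × Adj u v
      ; E-sym = λ (u∈S , v∈S , e) → v∈S , u∈S , adj-sym e
      ; E⊆Adj = λ (_ , _ , e) → e
      ; E-end = λ (u∈S , v∈S , _) → u∈S , v∈S
      } , refl
        , (λ (u∈S , v∈S , e) _ → contradiction
             (subst (Adj _) (single _ _ v∈S u∈S) e) adj-irrefl)
        , S≠∅ , λ u∈S v∈S → subst (Star _ _) (single _ _ u∈S v∈S) ε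
    unspan {S} (S≠∅ , inj₂ (k , conn)) = record
      { V     = S
      ; E     = Edge S k
      ; E-sym = λ (u∈S , v∈S , e , q) →
                  v∈S , u∈S , adj-sym e , trans (colour-sym (adj-sym e) e) q
      ; E⊆Adj = λ (_ , _ , e , _) → e
      ; E-end = λ (u∈S , v∈S , _) → u∈S , v∈S
      } , refl , (λ (_ , _ , _ , p) (_ , _ , _ , q) → trans p (sym q))
        , S≠∅ , λ u∈S v∈S → conn _ _ u∈S v∈S

    Parts : ∀ {t} → Vec (Subset n) t → Set
    Parts Vs = (∀ i → Spanned (lookup Vs i)) ×
               (∀ v → ∃[ i ] v ∈ lookup Vs i × (∀ j → v ∈ lookup Vs j → i ≡ j))

    parts? : ∀ {t} → U.Decidable (Parts {t})
    parts? Vs = all? (λ i → spanned? (lookup Vs i)) ×-dec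
      all? (λ v → any? λ i → v ∈? lookup Vs i ×-dec
        all? (λ j → (v ∈? lookup Vs j) →-dec (i ≟ᶠ j)))

    hasTreePartition? : U.Decidable (HasTreePartition c)
    hasTreePartition? s = map′ to from
      (anyUpTo? (λ t → anyVec? anySubset? {t} parts?) (suc s))
      where
      to : (∃[ t ] t < suc s × ∃ (Parts {t})) → HasTreePartition c s
      to (t , t<1+s , Vs , sp , un) =
        t , m<1+n⇒m≤n t<1+s , (λ i → proj₁ (unspan (sp i)))
          , (λ i → proj₁ (proj₂ (proj₂ (unspan (sp i)))))
          , (λ i → proj₂ (proj₂ (proj₂ (unspan (sp i)))))
          , λ v → let i , v∈ , uniq = un v in
              i , subst (v ∈_) (sym (V≡ i)) v∈
                , λ {j} v∈j → uniq j (subst (v ∈_) (V≡ j) v∈j)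
        where
        V≡ : ∀ i → Subgraph.V (proj₁ (unspan (sp i))) ≡ lookup Vs i
        V≡ i = proj₁ (proj₂ (unspan (sp i)))

      from : HasTreePartition c s → ∃[ t ] t < suc s × ∃ (Parts {t})
      from (t , t≤s , H , mono , conn , part) =
        t , s≤s t≤s , tabulate (Subgraph.V ∘ H)
          , (λ i → subst Spanned (sym (V≡ i)) (spans (H i) (mono i) (conn i)))
          , λ v → let i , v∈ , uniq = part v in
              i , subst (v ∈_) (sym (V≡ i)) v∈
                , λ j v∈j → uniq (subst (v ∈_) (V≡ j) v∈j)
        where
        V≡ : ∀ i → lookup (tabulate (Subgraph.V ∘ H)) i ≡ Subgraph.V (H i)
        V≡ = lookup∘tabulate (Subgraph.V ∘ H)

    singletons : HasTreePartition c n
    singletons = n , ≤-refl , (λ i → proj₁ (single i))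
      , (λ i → proj₁ (proj₂ (proj₂ (single i))))
      , (λ i → proj₂ (proj₂ (proj₂ (single i))))
      , λ v → v , x∈⁅x⁆ v , λ v∈ → x∈⁅y⁆⇒x≡y _ v∈
      where
      single : ∀ i → Σ (Subgraph G) λ H →
               Subgraph.V H ≡ ⁅ i ⁆ × Monochromatic c H × Connected H
      single i = unspan ((i , x∈⁅x⁆ i) , inj₁ λ u v u∈ v∈ →
        trans (x∈⁅y⁆⇒x≡y i u∈) (sym (x∈⁅y⁆⇒x≡y i v∈)))

  module _ (r : ℕ) {n : ℕ} (G : Graph n) where
    open Graph G
    open Colouring

    Matrix : Set
    Matrix = Vec (Vec (Maybe (Fin r)) n) n

    _at_,_ : Matrix → Fin n → Fin n → Maybe (Fin r)
    M at u , v = lookup (lookup M u) v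

    Valid : Matrix → Set
    Valid M = ∀ u v → Adj u v →
      ∃[ k ] M at u , v ≡ just k × M at v , u ≡ just k

    valid? : U.Decidable Valid
    valid? M = all? λ u → all? λ v → adj? u v →-dec
      any? λ k → (M at u , v) ≟ᵐ just k ×-dec (M at v , u) ≟ᵐ just k
      where _≟ᵐ_ = ≡-dec _≟ᶠ_

    decode : ∀ M → Valid M → Colouring r G
    decode M valid = record
      { colour     = λ e → proj₁ (valid _ _ e)
      ; colour-sym = λ e e′ → just-injective
          (trans (sym (proj₁ (proj₂ (valid _ _ e)))) (proj₂ (proj₂ (valid _ _ e′))))
      }

    module _ (c : Colouring r G) where

      entry : Fin n → Fin n → Maybe (Fin r)
      entry u v with adj? u v
      ... | yes e = just (colour c e)
      ... | no  _ = nothing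

      encode : Matrix
      encode = tabulate λ u → tabulate (entry u)

      encode-at : ∀ {u v} (e : Adj u v) → encode at u , v ≡ just (colour c e)
      encode-at {u} {v} e
        rewrite lookup∘tabulate (λ x → tabulate (entry x)) u
              | lookup∘tabulate (entry u) v
        with adj? u v
      ... | yes e′ = cong just (colour-irr c e′ e)
      ... | no  ¬e = contradiction e ¬e

      encode-valid : Valid encode
      encode-valid u v e = colour c e , encode-at e ,
        trans (encode-at (adj-sym e)) (cong just (sym (colour-sym c e (adj-sym e))))

    transfer : ∀ {s} (c d : Colouring r G) →
               (∀ {u v} (e : Adj u v) → colour c e ≡ colour d e) →
               HasTreePartition c s → HasTreePartition d s
    transfer c d c≗d (t , t≤s , H , mono , rest) =
      t , t≤s , H ,
      (λ i e f → trans (sym (c≗d _)) (trans (mono i e f) (c≗d _))) , rest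

    Bad : ℕ → Matrix → Set₁
    Bad s M = Σ (Valid M) λ valid → ¬ HasTreePartition (decode M valid) s

    bad? : ∀ s → U.Decidable (Bad s)
    bad? s M with valid? M
    ... | no ¬valid = no (¬valid ∘ proj₁)
    ... | yes w with hasTreePartition? (decode M w) s
    ...   | no ¬h = yes (w , ¬h)
    ...   | yes h = no λ (w′ , ¬h) → ¬h (transfer (decode M w) (decode M w′)
      (λ e → just-injective
        (trans (sym (proj₁ (proj₂ (w _ _ e)))) (proj₁ (proj₂ (w′ _ _ e))))) h)

    treePartitionable? : U.Decidable (TreePartitionable r G)
    treePartitionable? s
      with anyVec? (anyVec? (anyMaybe? any?)) (bad? s)
    ... | yes (M , w , ¬h) = no λ tp → ¬h (tp (decode M w))
    ... | no ¬bad = yes λ c → decidable-stable (hasTreePartition? c s) λ ¬h →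
      ¬bad (encode c , encode-valid c ,
            ¬h ∘ transfer (decode (encode c) (encode-valid c)) c (λ e → refl))

    treePartitionMinimum : ∃ (IsMinimum (TreePartitionable r G))
    treePartitionMinimum = minimum treePartitionable? n singletons

tp : ∀ {n} → ℕ → Graph n → ℕ
tp r G = proj₁ (treePartitionMinimum r G)

tp-isMinimum : ∀ {n} r (G : Graph n) →
               IsMinimum (TreePartitionable r G) (tp r G)
tp-isMinimum r G = proj₂ (treePartitionMinimum r G)

{-# OPTIONS --safe #-}
-- Suppose that k vertices are joined in k distinct colours to all of a set Y.
-- If every other vertex sends many edges in these colours to Y, then assigning
-- each vertex of Y at random to one of the k stars gives, with positive
-- probability, an assignment under which each other vertex can be attached to
-- some star, so that k trees partition the vertices.  Otherwise some vertex
-- sends a large share of its edges to Y in one of the r − k remaining colours,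
-- and serves as the centre of another star.  With all r colours in use no
-- share is lost to remaining colours, so the process stops.
--
-- If each random assignment is to meet more than m edges, then Y must have more
-- than m A(r−k) vertices at stage k ≥ 2, where A(0) = 1 and A(j+1) = (j+1) A(j) + 1.
-- One edge suffices at stage 1.  Hence n ≥ r (r−1) A(r−2) m + 2 vertices are
-- enough if n (1 − 1/r) ^ (m+1) < 1, which the union bound needs.
--
-- For r ≥ 64 and 2 ^ j ≤ r < 2 ^ (j+1), this follows from log r ≥ 0.68 j,
-- A(i) ≤ 2.72 i!, r! ≤ 2 ^ (j r) and (1 + 1/(r−1)) ^ (12 r) ≥ 2 ^ 17.  For
-- r < 64 the margin is too small for such estimates, and the inequality is
-- checked for each r, with a Darboux sum in place of log r.
module Submission where

open import Defs
open import Algebra.Definitions.RawMonoid using () renaming (sum to Σ[_])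
open import Data.Bool.Base using (true; false)
open import Data.Fin.Base using (Fin; zero; suc; toℕ)
open import Data.Fin.Properties
  using (any?) renaming (_≟_ to _≟ᶠ_; suc-injective to sucᶠ-injective; 0≢1+n to 0≢1+ᶠ)
open import Data.Fin.Subset using (Subset) renaming (_∈_ to _∈ˢ_)
open import Data.Integer.Base as ℤ using () renaming (+_ to pos)
import Data.Integer.Properties as ℤ
open import Data.List.Base using (List; []; _∷_; length; filter; map; allFin; tabulate)
open import Data.List.Membership.Propositional using (_∈_; _∉_; find; lose)
open import Data.List.Membership.Propositional.Properties
  using (∈-filter⁺; ∈-filter⁻; ∈-allFin; ∈-tabulate⁻)
open import Data.List.Properties using (length-filter; filter-notAll; length-tabulate)
open import Data.List.Relation.Unary.All as All using ()
open import Data.List.Relation.Unary.AllPairs using (_∷_)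
open import Data.List.Relation.Unary.Any as Any using (here; there)
open import Data.List.Relation.Unary.Unique.Propositional using (Unique)
open import Data.List.Relation.Unary.Unique.Propositional.Properties
  using () renaming (filter⁺ to unique-filter; tabulate⁺ to unique-tabulate)
open import Data.Nat using (ℕ; _≤_; _*_; _^_; _!)
open import Data.Nat.Base
open import Data.Nat.DivMod
open import Data.Nat.ListAction using (sum)
open import Data.Nat.Properties
open import Data.Nat.Solver using (module +-*-Solver)
open import Data.Product.Base using (Σ; ∃-syntax; _×_; _,_; proj₁; proj₂)
open import Data.Rational.Unnormalised.Base as ℚᵘ using (ℚᵘ; mkℚᵘ)
import Data.Rational.Unnormalised.Properties as ℚᵘ
open import Data.Sum.Base using (_⊎_; inj₁; inj₂)
open import Data.Unit.Base using (tt)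
open import Data.Vec.Base as Vec using ()
import Data.Vec.Functional as Vector
open import Data.Vec.Properties using (lookup∘tabulate; lookup⇒[]=; []=⇒lookup)
open import Relation.Binary.Construct.Closure.ReflexiveTransitive
  using (Star; ε; _◅_; _◅◅_)
open import Relation.Binary.Definitions using (DecidableEquality)
open import Relation.Binary.PropositionalEquality
open import Relation.Nullary using (Dec; yes; no; does; ¬_; contradiction)
open import Relation.Nullary.Decidable using (¬?; dec-true; _×-dec_; toWitness)
import Relation.Unary as U
open +-*-Solver

-- Monochromatic trees

module _ {A : Set} {Q : A → Set} (Q? : U.Decidable Q) where

  length-filter-split : ∀ xs → length xs ≡
    length (filter Q? xs) + length (filter (λ x → ¬? (Q? x)) xs)
  length-filter-split [] = refl
  length-filter-split (x ∷ xs) with Q? x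
  ... | yes _ = cong suc (length-filter-split xs)
  ... | no _  = trans (cong suc (length-filter-split xs)) (sym (+-suc _ _))

  length-filter-filter : ∀ {P : A → Set} (P? : U.Decidable P) xs →
    length (filter P? (filter Q? xs)) ≤ length (filter P? xs)
  length-filter-filter P? [] = z≤n
  length-filter-filter P? (x ∷ xs) with does (Q? x)
  ... | true with does (P? x)
  ...   | true  = s≤s (length-filter-filter P? xs)
  ...   | false = length-filter-filter P? xs
  length-filter-filter P? (x ∷ xs) | false with does (P? x)
  ...   | true  = m≤n⇒m≤1+n (length-filter-filter P? xs)
  ...   | false = length-filter-filter P? xs

module _ {A B : Set} (_≟_ : DecidableEquality B) (f : A → B) where

  -- If the fibre over `c` is small, discarding it costs at most `b` elements of `as`, so the bound
  -- persists for the other values.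
  pigeonhole : ∀ bs as → (∀ {a} → a ∈ as → f a ∈ bs) → ∀ b →
               length bs * b < length as →
               ∃[ c ] c ∈ bs × b < length (filter (λ a → f a ≟ c) as)
  pigeonhole [] [] _ b ()
  pigeonhole [] (a ∷ as) f∈ b lt with () ← f∈ (here refl)
  pigeonhole (c ∷ bs) as f∈ b lt with b <? length (filter (λ a → f a ≟ c) as)
  ... | yes b< = c , here refl , b<
  ... | no b≮ with pigeonhole bs as′ f∈′ b lt′
    where
    as′ = filter (λ a → ¬? (f a ≟ c)) as

    f∈′ : ∀ {a} → a ∈ as′ → f a ∈ bs
    f∈′ a∈ with ∈-filter⁻ (λ a → ¬? (f a ≟ c)) {xs = as} a∈
    ... | a∈as , fa≢c with f∈ a∈as
    ... | here fa≡c = contradiction fa≡c fa≢c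
    ... | there p   = p

    lt′ : length bs * b < length as′
    lt′ = +-cancelˡ-< b _ _ (begin-strict
      b + length bs * b       <⟨ lt ⟩
      length as               ≡⟨ length-filter-split (λ a → f a ≟ c) as ⟩
      length (filter (λ a → f a ≟ c) as) + length as′
                              ≤⟨ +-monoˡ-≤ _ (≮⇒≥ b≮) ⟩
      b + length as′          ∎)
      where open ≤-Reasoning
  ... | d , d∈bs , b< = d , there d∈bs , <-≤-trans b<
    (length-filter-filter (λ a → ¬? (f a ≟ c)) (λ a → f a ≟ d) as)
length-allFin : ∀ n → length (allFin n) ≡ n
length-allFin n = length-tabulate (λ i → i)

∃-smaller : ∀ {A : Set} (F : A → ℕ) B xs → sum (map F xs) < length xs * B →
            ∃[ x ] F x < B
∃-smaller F B (x ∷ xs) lt with F x <? B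
... | yes p = x , p
... | no ¬p = ∃-smaller F B xs (+-cancelˡ-< B _ _
  (≤-<-trans (+-monoˡ-≤ _ (≮⇒≥ ¬p)) lt))

-- The method of conditional expectations: f y is to be a uniformly random
-- index, and F zs ys is k ^ length ys times the expected number of z ∈ zs that
-- no y ∈ ys hits.
module Derandomised {Y Z C : Set} (_≟ʸ_ : DecidableEquality Y) (_≟_ : DecidableEquality C)
  {k′ : ℕ} (γ : Fin (suc k′) → C) (κ : Z → Y → C) where

  k = suc k′

  abstract
    hit? : ∀ z y → Dec (∃[ i ] κ z y ≡ γ i)
    hit? z y = any? λ i → κ z y ≟ γ i

  -- Of the `k` values of `f y`, at most `k′` miss `z` when `y` can hit it, and all `k` otherwise.
  -- The product bounds the number of assignments that leave `z` unattached.
  weight : Z → List Y → ℕ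
  weight z [] = 1
  weight z (y ∷ ys) with does (hit? z y)
  ... | true = k′ * weight z ys
  ... | false = k * weight z ys

  F : List Z → List Y → ℕ
  F zs ys = sum (map (λ z → weight z ys) zs)

  missed : Y → Fin k → List Z → List Z
  missed y i = filter (λ z → ¬? (κ z y ≟ γ i))

  -- Interchange of summation: `z` survives just the choices `i` that miss it, and their number is
  -- at most the factor that `y` contributes to `weight z`.
  average : ∀ y ys zs → sum (map (λ i → F (missed y i zs) ys) (allFin k)) ≤ F zs (y ∷ ys)
  average y ys [] = ≤-reflexive (zeros (allFin k))
    where
    zeros : ∀ (is : List (Fin k)) → sum (map (λ _ → 0) is) ≡ 0
    zeros [] = refl
    zeros (_ ∷ is) = zeros is
  average y ys (z ∷ zs) = begin
    sum (map (λ i → F (missed y i (z ∷ zs)) ys) (allFin k))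
      ≡⟨ split (allFin k) ⟩
    length (filter misses (allFin k)) * weight z ys + sum (map (λ i → F (missed y i zs) ys) (allFin k))
      ≤⟨ +-mono-≤ bound (average y ys zs) ⟩
    F (z ∷ zs) (y ∷ ys) ∎
    where
    open ≤-Reasoning
    misses : U.Decidable (λ i → ¬ (κ z y ≡ γ i))
    misses i = ¬? (κ z y ≟ γ i)

    split : ∀ is → sum (map (λ i → F (missed y i (z ∷ zs)) ys) is) ≡
      length (filter misses is) * weight z ys + sum (map (λ i → F (missed y i zs) ys) is)
    split [] = refl
    split (i ∷ is) with κ z y ≟ γ i
    ... | yes _ = trans (cong (F (missed y i zs) ys +_) (split is))
      (solve 3 (λ a b c → a :+ (b :+ c) := b :+ (a :+ c)) refl
        (F (missed y i zs) ys) (length (filter misses is) * weight z ys) _)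
    ... | no _ = trans (cong (weight z ys + F (missed y i zs) ys +_) (split is))
      (solve 4 (λ w a b c → w :+ a :+ (b :+ c) := w :+ b :+ (a :+ c)) refl
        (weight z ys) (F (missed y i zs) ys) (length (filter misses is) * weight z ys) _)

    bound : length (filter misses (allFin k)) * weight z ys ≤ weight z (y ∷ ys)
    bound with hit? z y
    ... | yes (i , eq) = *-monoˡ-≤ (weight z ys) {_} {k′} (≤-pred (≤-trans
      (filter-notAll misses (allFin k) (lose (∈-allFin i) λ ne → ne eq))
      (≤-reflexive (length-allFin k))))
    ... | no _ = *-monoˡ-≤ (weight z ys) {_} {k} (≤-trans
      (length-filter misses (allFin k)) (≤-reflexive (length-allFin k)))

  -- At each `y`, `average` supplies a value `i` that keeps `F` below the required power of `k`.
  -- Uniqueness ensures that fixing `f y` does not disturb the values on `ys`.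
  assign : ∀ {ys} → Unique ys → ∀ zs → F zs ys < k ^ length ys →
           Σ (Y → Fin k) λ f → ∀ {z} → z ∈ zs → ∃[ y ] y ∈ ys × κ z y ≡ γ (f y)
  assign {[]} _ [] _ = (λ _ → zero) , λ ()
  -- With every `y` used up, `F` is the number of vertices still missed, and it is below 1.
  assign {[]} _ (z ∷ zs) lt = contradiction lt (λ { (s≤s ()) })
  assign {y ∷ ys} (y∉ ∷ un) zs lt
    with ∃-smaller (λ i → F (missed y i zs) ys) (k ^ length ys) (allFin k)
           (<-≤-trans (≤-<-trans (average y ys zs) lt)
             (≤-reflexive (cong (_* k ^ length ys) (sym (length-allFin k)))))
  ... | i , lt′ with assign un (missed y i zs) lt′
  ... | f , f-hits = f′ , hits
    where
    f′ : Y → Fin k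
    f′ v with y ≟ʸ v
    ... | yes _ = i
    ... | no _  = f v

    f′-y : f′ y ≡ i
    f′-y with y ≟ʸ y
    ... | yes _ = refl
    ... | no ne = contradiction refl ne

    f′-ys : ∀ {v} → v ∈ ys → f′ v ≡ f v
    f′-ys {v} v∈ with y ≟ʸ v
    ... | yes y≡v = contradiction y≡v (All.lookup y∉ v∈)
    ... | no _ = refl

    hits : ∀ {z} → z ∈ zs → ∃[ v ] v ∈ y ∷ ys × κ z v ≡ γ (f′ v)
    hits {z} z∈ with κ z y ≟ γ i
    ... | yes eq = y , here refl , trans eq (cong γ (sym f′-y))
    ... | no ne with f-hits (∈-filter⁺ (λ z → ¬? (κ z y ≟ γ i)) z∈ ne)
    ... | v , v∈ , eq = v , there v∈ , trans eq (cong γ (sym (f′-ys v∈)))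

  -- Each of `g` hits contributes a factor `k′ / k`; denominators are cleared.
  weight-bound : ∀ z g ys → g ≤ length (filter (hit? z) ys) →
                 weight z ys * k ^ g ≤ k′ ^ g * k ^ length ys
  weight-bound z zero [] _ = ≤-refl
  weight-bound z g (y ∷ ys) g≤ with hit? z y
  weight-bound z g (y ∷ ys) g≤ | no _ = begin
    k * weight z ys * k ^ g     ≡⟨ *-assoc k (weight z ys) (k ^ g) ⟩
    k * (weight z ys * k ^ g)   ≤⟨ *-monoʳ-≤ k (weight-bound z g ys g≤) ⟩
    k * (k′ ^ g * k ^ length ys)
      ≡⟨ solve 3 (λ a b c → a :* (b :* c) := b :* (a :* c)) refl k (k′ ^ g) _ ⟩
    k′ ^ g * (k * k ^ length ys) ∎
    where open ≤-Reasoning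
  -- All `g` factors are spent, so a further hit is only estimated by `k′ ≤ k`.
  weight-bound z zero (y ∷ ys) g≤ | yes _ = begin
    k′ * weight z ys * 1        ≡⟨ *-assoc k′ _ _ ⟩
    k′ * (weight z ys * 1)      ≤⟨ *-mono-≤ (n≤1+n k′) (weight-bound z 0 ys z≤n) ⟩
    k * (1 * k ^ length ys)     ≡⟨ cong (k *_) (*-identityˡ _) ⟩
    k * k ^ length ys           ≡⟨ *-identityˡ _ ⟨
    1 * (k * k ^ length ys)     ∎
    where open ≤-Reasoning
  weight-bound z (suc g) (y ∷ ys) (s≤s g≤) | yes _ = begin
    k′ * weight z ys * (k * k ^ g)
      ≡⟨ solve 4 (λ a w b c → a :* w :* (b :* c) := a :* b :* (w :* c)) refl k′ (weight z ys) k (k ^ g) ⟩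
    k′ * k * (weight z ys * k ^ g)
      ≤⟨ *-monoʳ-≤ (k′ * k) (weight-bound z g ys g≤) ⟩
    k′ * k * (k′ ^ g * k ^ length ys)
      ≡⟨ solve 4 (λ a b c d → a :* b :* (c :* d) := a :* c :* (b :* d)) refl k′ k (k′ ^ g) _ ⟩
    k′ * k′ ^ g * (k * k ^ length ys) ∎
    where open ≤-Reasoning

  F-bound : ∀ g ys zs → (∀ {z} → z ∈ zs → g ≤ length (filter (hit? z) ys)) →
            F zs ys * k ^ g ≤ length zs * k′ ^ g * k ^ length ys
  F-bound g ys [] _ = z≤n
  F-bound g ys (z ∷ zs) hyp = begin
    (weight z ys + F zs ys) * k ^ g          ≡⟨ *-distribʳ-+ (k ^ g) (weight z ys) _ ⟩
    weight z ys * k ^ g + F zs ys * k ^ g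
      ≤⟨ +-mono-≤ (weight-bound z g ys (hyp (here refl))) (F-bound g ys zs (λ z∈ → hyp (there z∈))) ⟩
    k′ ^ g * k ^ length ys + length zs * k′ ^ g * k ^ length ys
      ≡⟨ *-distribʳ-+ (k ^ length ys) (k′ ^ g) _ ⟨
    (k′ ^ g + length zs * k′ ^ g) * k ^ length ys ∎
    where open ≤-Reasoning

  -- The union bound: the expected number of misses is at most `length zs * (k′ / k) ^ g`, which the
  -- last inequality puts below 1.
  hitting : ∀ g {ys} → Unique ys → ∀ zs →
            (∀ {z} → z ∈ zs → g ≤ length (filter (hit? z) ys)) →
            length zs * k′ ^ g < k ^ g →
            Σ (Y → Fin k) λ f → ∀ {z} → z ∈ zs → ∃[ y ] y ∈ ys × κ z y ≡ γ (f y)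
  hitting g {ys} un zs hyp lt = assign un zs (*-cancelʳ-< (k ^ g) _ _ (begin-strict
    F zs ys * k ^ g                          ≤⟨ F-bound g ys zs hyp ⟩
    length zs * k′ ^ g * k ^ length ys       <⟨ *-monoˡ-< (k ^ length ys) {{m^n≢0 k (length ys)}} lt ⟩
    k ^ g * k ^ length ys                    ≡⟨ *-comm (k ^ g) _ ⟩
    k ^ length ys * k ^ g                    ∎))
    where open ≤-Reasoning

-- Trees from an assignment of vertices to roots

fibre : ∀ {k n} → (Fin n → Fin k) → Fin k → Subset n
fibre f i = Vec.tabulate λ v → does (f v ≟ᶠ i)

∈-fibre⁺ : ∀ {k n} (f : Fin n → Fin k) {i v} → f v ≡ i → v ∈ˢ fibre f i
∈-fibre⁺ f {i} {v} eq = lookup⇒[]= v _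
  (trans (lookup∘tabulate (λ v → does (f v ≟ᶠ i)) v) (dec-true (f v ≟ᶠ i) eq))

∈-fibre⁻ : ∀ {k n} (f : Fin n → Fin k) {i v} → v ∈ˢ fibre f i → f v ≡ i
∈-fibre⁻ f {i} {v} v∈ with f v ≟ᶠ i
  | trans (sym (lookup∘tabulate (λ v → does (f v ≟ᶠ i)) v)) ([]=⇒lookup v∈)
... | yes eq | _ = eq

-- The number of sequences without repetition over `j` elements, that is the sum of `j ! / i !` over
-- `i ≤ j`, which is less than `e * j !`.
arrangements : ℕ → ℕ
arrangements zero    = 1
arrangements (suc j) = suc j * arrangements j + 1

module Partition {r′ n′ : ℕ} (c : Colouring (suc r′) (K (suc n′))) where

  open Colouring c

  private
    r = suc r′
    n = suc n′

  -- The colour of a loop is a dummy.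
  col : Fin n → Fin n → Fin r
  col u v with u ≟ᶠ v
  ... | yes _  = zero
  ... | no u≢v = colour u≢v

  colour≡col : ∀ {u v} (e : u ≢ v) → colour e ≡ col u v
  colour≡col {u} {v} e with u ≟ᶠ v
  ... | yes u≡v = contradiction u≡v e
  ... | no e′ = trans (colour-sym e (≢-sym e)) (colour-sym (≢-sym e) e′)

  col-sym : ∀ u v → col u v ≡ col v u
  col-sym u v with u ≟ᶠ v | v ≟ᶠ u
  ... | yes _   | yes _   = refl
  ... | yes u≡v | no v≢u  = contradiction (sym u≡v) v≢u
  ... | no u≢v  | yes v≡u = contradiction (sym v≡u) u≢v
  ... | no u≢v  | no v≢u  = colour-sym u≢v v≢u

  module _ {k : ℕ} (γ : Fin k → Fin r) (owner : Fin n → Fin k) where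

    Edge : Fin k → Fin n → Fin n → Set
    Edge i u v = owner u ≡ i × owner v ≡ i × u ≢ v × col u v ≡ γ i

    edge-sym : ∀ {i u v} → Edge i u v → Edge i v u
    edge-sym {i} {u} {v} (p , q , ne , eq) = q , p , ≢-sym ne , trans (col-sym v u) eq

    reverse : ∀ {i u v} → Star (Edge i) u v → Star (Edge i) v u
    reverse ε        = ε
    reverse (e ◅ es) = reverse es ◅◅ edge-sym e ◅ ε

    -- Vertices with the same owner are connected through its root, and the fibres of `owner`
    -- partition the vertices. As `root i` has owner `i`, every fibre is nonempty.
    owned-trees : (root : Fin k → Fin n) → (∀ i → owner (root i) ≡ i) →
                  (∀ v → Star (Edge (owner v)) (root (owner v)) v) →
                  HasTreePartition c k
    owned-trees root owner-root path = k , ≤-refl , tree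
      , (λ i (_ , _ , ne , p) (_ , _ , ne′ , q) →
           trans (colour≡col ne) (trans p (sym (trans (colour≡col ne′) q))))
      , (λ i → (root i , ∈-fibre⁺ owner (owner-root i)) , λ u∈ v∈ →
           reverse (path′ (∈-fibre⁻ owner u∈)) ◅◅ path′ (∈-fibre⁻ owner v∈))
      , λ v → owner v , ∈-fibre⁺ owner refl , ∈-fibre⁻ owner
      where
      tree : Fin k → Subgraph (K n)
      tree i = record
        { V     = fibre owner i
        ; E     = Edge i
        ; E-sym = edge-sym
        ; E⊆Adj = λ (_ , _ , ne , _) → ne
        ; E-end = λ (p , q , _) → ∈-fibre⁺ owner p , ∈-fibre⁺ owner q
        }

      path′ : ∀ {i v} → owner v ≡ i → Star (Edge i) (root i) v
      path′ refl = path _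

  -- root i is joined to all of Y in colour γ i, and rest holds the colours
  -- that are not yet used; there are at most j of them.
  record Stage (k j : ℕ) : Set where
    field
      root   : Fin k → Fin n
      γ      : Fin k → Fin r
      Y      : List (Fin n)
      rest   : List (Fin r)
      root-injective : ∀ {i i′} → root i ≡ root i′ → i ≡ i′
      Y-unique : Unique Y
      root≢Y : ∀ i {y} → y ∈ Y → root i ≢ y
      joined : ∀ i {y} → y ∈ Y → col (root i) y ≡ γ i
      ∣rest∣ : length rest ≤ j
      exhaust : ∀ x → (∃[ i ] x ≡ γ i) ⊎ x ∈ rest

  module _ {k′ j : ℕ} (S : Stage (suc k′) j) where
    open Stage S
    open Derandomised _≟ᶠ_ _≟ᶠ_ γ col using (hit?; hitting)

    private
      k = suc k′

    Outer : Fin n → Set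
    Outer z = ¬ (∃[ i ] root i ≡ z) × z ∉ Y

    outer? : U.Decidable Outer
    outer? z = ¬? (any? λ i → root i ≟ᶠ z) ×-dec ¬? (Any.any? (z ≟ᶠ_) Y)

    Z : List (Fin n)
    Z = filter outer? (allFin n)

    ∣Z∣≤n′ : length Z ≤ n′
    ∣Z∣≤n′ = ≤-pred (≤-trans
      (filter-notAll outer? (allFin n) (lose (∈-allFin (root zero)) λ (¬root , _) → ¬root (zero , refl)))
      (≤-reflexive (length-allFin _)))

    -- Roots keep their index, `y ∈ Y` gets `f y`, and an outer `z` takes the index of a `y` that
    -- hits it, so that the path from the root through `y` to `z` has a single colour.
    partition : (f : Fin n → Fin k) →
                (∀ {z} → z ∈ Z → ∃[ y ] y ∈ Y × col z y ≡ γ (f y)) →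
                HasTreePartition c k
    partition f hits = owned-trees γ owner root owner-root path
      where
      owner : Fin n → Fin k
      owner v with any? (λ i → root i ≟ᶠ v)
      ... | yes (i , _) = i
      ... | no ¬root with Any.any? (v ≟ᶠ_) Y
      ... | yes _ = f v
      ... | no v∉Y = f (proj₁ (hits (∈-filter⁺ outer? (∈-allFin v) (¬root , v∉Y))))

      owner-root : ∀ i → owner (root i) ≡ i
      owner-root i with any? (λ i′ → root i′ ≟ᶠ root i)
      ... | yes (_ , eq) = root-injective eq
      ... | no ¬root = contradiction (i , refl) ¬root

      owner-Y : ∀ {y} → y ∈ Y → owner y ≡ f y
      owner-Y {y} y∈Y with any? (λ i → root i ≟ᶠ y)
      ... | yes (i , eq) = contradiction eq (root≢Y i y∈Y)
      ... | no _ with Any.any? (y ≟ᶠ_) Y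
      ... | yes _ = refl
      ... | no y∉Y = contradiction y∈Y y∉Y

      classify : ∀ v → v ≡ root (owner v) ⊎ v ∈ Y ⊎
                 (∃[ y ] y ∈ Y × v ≢ y × col v y ≡ γ (owner v) × f y ≡ owner v)
      classify v with any? (λ i → root i ≟ᶠ v)
      ... | yes (i , eq) = inj₁ (sym eq)
      ... | no ¬root with Any.any? (v ≟ᶠ_) Y
      ... | yes v∈Y = inj₂ (inj₁ v∈Y)
      ... | no v∉Y with hits (∈-filter⁺ outer? (∈-allFin v) (¬root , v∉Y))
      ... | y , y∈Y , eq = inj₂ (inj₂ (y , y∈Y , (λ v≡y → v∉Y (subst (_∈ Y) (sym v≡y) y∈Y)) , eq , refl))

      spoke : ∀ {i y} → y ∈ Y → owner y ≡ i → Edge γ owner i (root i) y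
      spoke {i} y∈Y eq = owner-root i , eq , root≢Y i y∈Y , joined i y∈Y

      path : ∀ v → Star (Edge γ owner (owner v)) (root (owner v)) v
      path v with classify v
      ... | inj₁ eq = subst (Star _ _) (sym eq) ε
      ... | inj₂ (inj₁ v∈Y) = spoke v∈Y refl ◅ ε
      ... | inj₂ (inj₂ (y , y∈Y , v≢y , eq , fy)) =
        spoke y∈Y owner-y
        ◅ (owner-y , refl , ≢-sym v≢y , trans (col-sym y v) eq) ◅ ε
        where owner-y = trans (owner-Y y∈Y) fy

    -- `z` becomes a root of colour `d`, and `Y` shrinks to its neighbours in that colour. As
    -- `d ∈ rest`, `j` is positive and `pred j` is a true predecessor.
    extend : ∀ {z d b} → z ∈ Z → d ∈ rest →
             b < length (filter (λ y → col z y ≟ᶠ d) Y) →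
             ∃[ j′ ] suc j′ ≡ j × Σ (Stage (suc k) j′) λ S′ → b < length (Stage.Y S′)
    extend {z} {d} z∈Z d∈rest b< = pred j , suc-pred j {{>-nonZero 0<j}} , record
      { root = z Vector.∷ root
      ; γ    = d Vector.∷ γ
      ; Y    = filter inN? Y
      ; rest = filter (λ x → ¬? (d ≟ᶠ x)) rest
      ; root-injective = injective
      ; Y-unique = unique-filter inN? Y-unique
      ; root≢Y = λ { zero y∈ z≡y → z∉Y (subst (_∈ Y) (sym z≡y) (⊆Y y∈))
                   ; (suc i) y∈ → root≢Y i (⊆Y y∈) }
      ; joined = λ { zero y∈ → proj₂ (∈-filter⁻ inN? {xs = Y} y∈)
                   ; (suc i) y∈ → joined i (⊆Y y∈) }
      ; ∣rest∣ = ≤-pred (≤-trans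
          (filter-notAll (λ x → ¬? (d ≟ᶠ x)) rest (lose d∈rest λ ne → ne refl))
          (≤-trans ∣rest∣ (≤-reflexive (sym (suc-pred j {{>-nonZero 0<j}})))))
      ; exhaust = exhaust′
      } , b<
      where
      0<j : 0 < j
      0<j = ≤-trans (nonempty d∈rest) ∣rest∣
        where
        nonempty : ∀ {x : Fin r} {xs} → x ∈ xs → 0 < length xs
        nonempty (here _)  = s≤s z≤n
        nonempty (there _) = s≤s z≤n

      inN? : U.Decidable (λ y → col z y ≡ d)
      inN? y = col z y ≟ᶠ d

      z-outer : Outer z
      z-outer = proj₂ (∈-filter⁻ outer? {xs = allFin n} z∈Z)
      z∉Y = proj₂ z-outer

      ⊆Y : ∀ {y} → y ∈ filter inN? Y → y ∈ Y
      ⊆Y y∈ = proj₁ (∈-filter⁻ inN? {xs = Y} y∈)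

      injective : ∀ {i i′} → (z Vector.∷ root) i ≡ (z Vector.∷ root) i′ → i ≡ i′
      injective {zero}  {zero}   _  = refl
      injective {zero}  {suc i′} eq = contradiction (i′ , sym eq) (proj₁ z-outer)
      injective {suc i} {zero}   eq = contradiction (i , eq) (proj₁ z-outer)
      injective {suc i} {suc i′} eq = cong suc (root-injective eq)

      exhaust′ : ∀ x → (∃[ i ] x ≡ (d Vector.∷ γ) i) ⊎ x ∈ filter (λ x → ¬? (d ≟ᶠ x)) rest
      exhaust′ x with d ≟ᶠ x | exhaust x
      ... | yes d≡x | _ = inj₁ (zero , sym d≡x)
      ... | no _   | inj₁ (i , eq) = inj₁ (suc i , eq)
      ... | no d≢x | inj₂ x∈ = inj₂ (∈-filter⁺ (λ x → ¬? (d ≟ᶠ x)) x∈ d≢x)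

    -- If every outer vertex sends at least `g` edges to `Y` in used colours, the union bound
    -- applies. Otherwise some `z` sends more than `j * b` edges to `Y` in colours from `rest`, and
    -- one of these colours takes more than `b`.
    dichotomy : ∀ g b → g + j * b ≤ length Y → n′ * k′ ^ g < k ^ g →
                HasTreePartition c k ⊎
                ∃[ j′ ] suc j′ ≡ j × Σ (Stage (suc k) j′) λ S′ → b < length (Stage.Y S′)
    dichotomy g b big small
      with Any.any? (λ z → length (filter (hit? z) Y) <? g) Z
    ... | yes few with find few
    ... | z , z∈Z , few-z
      with pigeonhole _≟ᶠ_ (col z) rest (filter (λ y → ¬? (hit? z y)) Y) in-rest b many
      where
      in-rest : ∀ {y} → y ∈ filter (λ y → ¬? (hit? z y)) Y → col z y ∈ rest
      in-rest {y} y∈ with ∈-filter⁻ (λ y → ¬? (hit? z y)) {xs = Y} y∈ | exhaust (col z y)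
      ... | _ , ¬hit | inj₁ hit = contradiction hit ¬hit
      ... | _ | inj₂ x∈ = x∈

      many : length rest * b < length (filter (λ y → ¬? (hit? z y)) Y)
      many = +-cancelˡ-< g _ _ (begin-strict
        g + length rest * b  ≤⟨ +-monoʳ-≤ g (*-monoˡ-≤ b ∣rest∣) ⟩
        g + j * b            ≤⟨ big ⟩
        length Y             ≡⟨ length-filter-split (hit? z) Y ⟩
        length (filter (hit? z) Y) + _   <⟨ +-monoˡ-< _ few-z ⟩
        g + _                ∎)
        where open ≤-Reasoning
    ... | d , d∈rest , b< = inj₂ (extend z∈Z d∈rest (<-≤-trans b<
      (length-filter-filter (λ y → ¬? (hit? z y)) (λ y → col z y ≟ᶠ d) Y)))
    dichotomy g b big small | no ¬few =
      let f , hits = hitting g Y-unique Z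
            (λ z∈ → ≮⇒≥ λ lt → ¬few (lose z∈ lt))
            (≤-<-trans (*-monoˡ-≤ (k′ ^ g) ∣Z∣≤n′) small)
      in inj₁ (partition f hits)

  weaken : ∀ {s t} → s ≤ t → HasTreePartition c s → HasTreePartition c t
  weaken s≤t (p , p≤s , rest) = p , ≤-trans p≤s s≤t , rest

  -- The invariant is `m * arrangements j < length Y`. The recurrence for `arrangements` splits this
  -- into `suc m` hits and `j` colours with `m * arrangements (pred j)` vertices each, so the next
  -- stage inherits it. At `j = 0` no next stage exists.
  finish : ∀ m {k j} → (∀ {i} → i ≤ r′ → n′ * i ^ suc m < suc i ^ suc m) →
           (S : Stage (suc k) j) → k + j ≡ r′ →
           m * arrangements j < length (Stage.Y S) → HasTreePartition c r
  finish m {k} {j} small S k+j≡r′ big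
    with dichotomy S (suc m) (m * arrangements (pred j)) (bound j big) (small k≤r′)
    where
    k≤r′ : k ≤ r′
    k≤r′ = subst (k ≤_) k+j≡r′ (m≤m+n k j)
    -- For `j = 0` the term with `arrangements (pred j)` is multiplied by 0.
    bound : ∀ j {l} → m * arrangements j < l → suc m + j * (m * arrangements (pred j)) ≤ l
    bound zero {l} lt = subst (_≤ l) (cong suc (trans (*-identityʳ m) (sym (+-identityʳ m)))) lt
    bound (suc j) {l} lt = subst (_≤ l) (cong suc
      (solve 3 (λ m j a → m :* ((con 1 :+ j) :* a :+ con 1) := m :+ (con 1 :+ j) :* (m :* a)) refl m j (arrangements j))) lt
  ... | inj₁ h = weaken (s≤s (subst (k ≤_) k+j≡r′ (m≤m+n k j))) h
  finish m {k} {suc j} small S k+j≡r′ big | inj₂ (_ , refl , S′ , big′) =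
    finish m small S′ (trans (sym (+-suc k j)) k+j≡r′) big′

  -- With a single root every assignment is the same, so that one neighbour in Y
  -- is enough for a vertex to be attached.
  treePartition : ∀ m {s} → r′ ≡ suc s →
    suc r′ * (r′ * (m * arrangements s)) < n′ →
    (∀ {i} → i ≤ r′ → n′ * i ^ suc m < suc i ^ suc m) →
    HasTreePartition c r
  treePartition m {s} r′≡1+s big small
    with pigeonhole _≟ᶠ_ (col zero) (allFin r) others (λ _ → ∈-allFin _) (r′ * (m * arrangements s))
           (subst₂ (λ x y → x * (r′ * (m * arrangements s)) < y) (sym (length-allFin r)) (sym (length-tabulate {n = n′} suc)) big)
    where
    others : List (Fin n)
    others = tabulate suc
  ... | d , _ , b< = finish₁
    where
    others : List (Fin n)
    others = tabulate suc

    inN? : U.Decidable (λ y → col zero y ≡ d)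
    inN? y = col zero y ≟ᶠ d

    S₁ : Stage 1 r′
    S₁ = record
      { root = λ _ → zero
      ; γ    = λ _ → d
      ; Y    = filter inN? others
      ; rest = filter (λ x → ¬? (d ≟ᶠ x)) (allFin r)
      ; root-injective = λ { {zero} {zero} _ → refl }
      ; Y-unique = unique-filter inN? (unique-tabulate sucᶠ-injective)
      ; root≢Y = λ _ y∈ 0≡y →
          let _ , y≡ = ∈-tabulate⁻ (proj₁ (∈-filter⁻ inN? {xs = others} y∈))
          in 0≢1+ᶠ (trans 0≡y y≡)
      ; joined = λ _ y∈ → proj₂ (∈-filter⁻ inN? {xs = others} y∈)
      ; ∣rest∣ = ≤-pred (≤-trans
          (filter-notAll (λ x → ¬? (d ≟ᶠ x)) (allFin r) (lose (∈-allFin d) λ ne → ne refl))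
          (≤-reflexive (length-allFin _)))
      ; exhaust = exhaust₁
      }
      where
      exhaust₁ : ∀ x → (∃[ i ] x ≡ d) ⊎ x ∈ filter (λ x → ¬? (d ≟ᶠ x)) (allFin r)
      exhaust₁ x with d ≟ᶠ x
      ... | yes d≡x = inj₁ (zero {0} , sym d≡x)
      ... | no d≢x  = inj₂ (∈-filter⁺ (λ x → ¬? (d ≟ᶠ x)) (∈-allFin x) d≢x)

    finish₁ : HasTreePartition c r
    -- With one root `k′ = 0`, so `g = 1` turns the union-bound condition into `0 < 1`.
    finish₁ with dichotomy S₁ 1 (m * arrangements s) b< (subst (_< 1) (sym (*-zeroʳ n′)) (s≤s z≤n))
    ... | inj₁ h = weaken (s≤s z≤n) h
    ... | inj₂ (j′ , eq , S₂ , big₂) = finish m small S₂ eq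
      (subst (λ x → m * arrangements x < length (Stage.Y S₂)) (suc-injective (trans (sym r′≡1+s) (sym eq))) big₂)

-- Lower bounds for the logarithm

-- A lower bound for D times the sum of 1/m over N < m ≤ N + l.
darboux : ℕ → ℕ → ℕ → ℕ
darboux D N zero    = 0
darboux D N (suc l) = D / suc N + darboux D (suc N) l

private
  fromℕ : ℕ → ℚᵘ
  fromℕ n = mkℚᵘ (pos n) 0

  fromℕ-+ : ∀ m n → fromℕ (m + n) ℚᵘ.≃ fromℕ m ℚᵘ.+ fromℕ n
  fromℕ-+ m n = ℚᵘ.*≡* (cong (ℤ._* pos 1)
    (trans (ℤ.pos-+ m n) (sym (cong₂ ℤ._+_ (ℤ.*-identityʳ (pos m)) (ℤ.*-identityʳ (pos n))))))

  quotient-≤ : ∀ D N → fromℕ (D / suc N) ℚᵘ.≤ fromℕ D ℚᵘ.* mkℚᵘ (pos 1) N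
  quotient-≤ D N = ℚᵘ.*≤* (subst₂ ℤ._≤_
    (trans (ℤ.pos-* (D / suc N) (suc N)) (cong (λ d → pos (D / suc N) ℤ.* pos (suc d)) (sym (+-identityʳ N))))
    (sym (trans (ℤ.*-identityʳ _) (ℤ.*-identityʳ (pos D))))
    (ℤ.+≤+ (m/n*n≤m D (suc N))))

  -- The denominators are a function `e` because those of the tail agree with a sum started at
  -- `suc N` only propositionally.
  darboux-≤ : ∀ D N l (e : Fin l → ℕ) → (∀ i → e i ≡ N + toℕ i) →
    fromℕ (darboux D N l) ℚᵘ.≤
    fromℕ D ℚᵘ.* Σ[ ℚᵘ.+-0-rawMonoid ] (λ i → mkℚᵘ (pos 1) (e i))
  darboux-≤ D N zero e _ = ℚᵘ.≤-reflexive (ℚᵘ.≃-sym (ℚᵘ.*-zeroʳ (fromℕ D)))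
  darboux-≤ D N (suc l) e e≡ = begin
    fromℕ (D / suc N + darboux D (suc N) l)
      ≃⟨ fromℕ-+ (D / suc N) _ ⟩
    fromℕ (D / suc N) ℚᵘ.+ fromℕ (darboux D (suc N) l)
      ≤⟨ ℚᵘ.+-mono-≤
           (subst (λ x → fromℕ (D / suc N) ℚᵘ.≤ fromℕ D ℚᵘ.* mkℚᵘ (pos 1) x)
             (sym (trans (e≡ zero) (+-identityʳ N))) (quotient-≤ D N))
           (darboux-≤ D (suc N) l (λ i → e (suc i)) (λ i → trans (e≡ (suc i)) (+-suc N (toℕ i)))) ⟩
    fromℕ D ℚᵘ.* mkℚᵘ (pos 1) (e zero) ℚᵘ.+ fromℕ D ℚᵘ.* rest
      ≃⟨ ℚᵘ.*-distribˡ-+ (fromℕ D) (mkℚᵘ (pos 1) (e zero)) rest ⟨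
    fromℕ D ℚᵘ.* (mkℚᵘ (pos 1) (e zero) ℚᵘ.+ rest) ∎
    where
    open ℚᵘ.≤-Reasoning
    rest = Σ[ ℚᵘ.+-0-rawMonoid ] (λ i → mkℚᵘ (pos 1) (e (suc i)))

  fromℕ-*-≤ : ∀ a b c d → fromℕ a ℚᵘ.* fromℕ b ℚᵘ.≤ fromℕ c ℚᵘ.* fromℕ d → a * b ≤ c * d
  fromℕ-*-≤ a b c d le = ℤ.drop‿+≤+ (subst₂ ℤ._≤_ (eq a b) (eq c d) (ℚᵘ.drop-*≤* le))
    where
    eq : ∀ x y → pos x ℤ.* pos y ℤ.* pos 1 ≡ pos (x * y)
    eq x y = trans (ℤ.*-identityʳ _) (sym (ℤ.pos-* x y))

darboux-bound : ∀ c r n → c ·ᴿ log r ≤ᴿ fromℕᴿ n →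
                ∀ k D → c * darboux D (suc k) ((r ∸ 1) * suc k) ≤ D * n
darboux-bound c r n hyp k D = fromℕ-*-≤ c _ D n (begin
  fromℕ c ℚᵘ.* fromℕ T               ≤⟨ ℚᵘ.*-monoʳ-≤-nonNeg (fromℕ c)
                                          (darboux-≤ D (suc k) ((r ∸ 1) * suc k) (λ i → k + suc (toℕ i)) (λ i → +-suc k (toℕ i))) ⟩
  fromℕ c ℚᵘ.* (fromℕ D ℚᵘ.* S)      ≃⟨ ℚᵘ.*-assoc (fromℕ c) (fromℕ D) S ⟨
  fromℕ c ℚᵘ.* fromℕ D ℚᵘ.* S        ≃⟨ ℚᵘ.*-congʳ {S} (ℚᵘ.*-comm (fromℕ c) (fromℕ D)) ⟩
  fromℕ D ℚᵘ.* fromℕ c ℚᵘ.* S        ≃⟨ ℚᵘ.*-assoc (fromℕ D) (fromℕ c) S ⟩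
  fromℕ D ℚᵘ.* (fromℕ c ℚᵘ.* S)      ≤⟨ ℚᵘ.*-monoʳ-≤-nonNeg (fromℕ D)
                                          -- If `c * S` exceeded `n`, the hypothesis at `q = n`
                                          -- would give `n < n`.
                                          (ℚᵘ.≮⇒≥ λ lt → ℚᵘ.<-irrefl ℚᵘ.≃-refl (proj₂ (hyp (fromℕ n) (k , lt)))) ⟩
  fromℕ D ℚᵘ.* fromℕ n               ∎)
  where
  open ℚᵘ.≤-Reasoning
  T = darboux D (suc k) ((r ∸ 1) * suc k)
  S = log r k

darboux-+ : ∀ D N a b → darboux D N (a + b) ≡ darboux D N a + darboux D (N + a) b
darboux-+ D N zero    b = cong (λ x → darboux D x b) (sym (+-identityʳ N))
darboux-+ D N (suc a) b = begin
  D / suc N + darboux D (suc N) (a + b)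
    ≡⟨ cong (λ x → D / suc N + x) (darboux-+ D (suc N) a b) ⟩
  D / suc N + (darboux D (suc N) a + darboux D (suc N + a) b)
    ≡⟨ +-assoc (D / suc N) _ _ ⟨
  D / suc N + darboux D (suc N) a + darboux D (suc N + a) b
    ≡⟨ cong (λ x → D / suc N + darboux D (suc N) a + darboux D x b) (sym (+-suc N a)) ⟩
  D / suc N + darboux D (suc N) a + darboux D (N + suc a) b ∎
  where open ≡-Reasoning

darboux-mono : ∀ D N {a b} → a ≤ b → darboux D N a ≤ darboux D N b
darboux-mono D N z≤n     = z≤n
darboux-mono D N (s≤s p) = +-monoʳ-≤ (D / suc N) (darboux-mono D (suc N) p)

*-/-≤ : ∀ q m n .{{_ : NonZero n}} → q * (m / n) ≤ q * m / n
*-/-≤ q m n = begin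
  q * (m / n)         ≡⟨ m*n/n≡m (q * (m / n)) n ⟨
  q * (m / n) * n / n ≤⟨ /-monoˡ-≤ n (≤-trans (≤-reflexive (*-assoc q _ n)) (*-monoʳ-≤ q (m/n*n≤m m n))) ⟩
  q * m / n           ∎
  where open ≤-Reasoning

darboux-scale : ∀ q D N l → q * darboux D N l ≤ darboux (q * D) N l
darboux-scale q D N zero    = ≤-reflexive (*-zeroʳ q)
darboux-scale q D N (suc l) = ≤-trans
  (≤-reflexive (*-distribˡ-+ q (D / suc N) _))
  (+-mono-≤ (*-/-≤ q D (suc N)) (darboux-scale q D (suc N) l))

-- 1/(2m−1) + 1/(2m) ≥ 1/m
darboux-double : ∀ D N l → 2 * darboux D N l ≤ darboux (2 * D) (N + N) (l + l)
darboux-double D N zero    = z≤n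
darboux-double D N (suc l) = begin
  2 * (D / suc N + darboux D (suc N) l)
    ≡⟨ solve 2 (λ a b → con 2 :* (a :+ b) := a :+ (a :+ con 2 :* b)) refl (D / suc N) _ ⟩
  D / suc N + (D / suc N + 2 * darboux D (suc N) l)
    ≤⟨ +-mono-≤ (term (n≤1+n (suc (N + N))))
         (+-mono-≤ (term ≤-refl) (darboux-double D (suc N) l)) ⟩
  2 * D / suc (N + N) + (2 * D / suc (suc (N + N)) + darboux (2 * D) (suc N + suc N) (l + l))
    ≡⟨ cong (λ x → 2 * D / suc (N + N) + (2 * D / suc (suc (N + N)) + darboux (2 * D) (suc x) (l + l)))
         (+-suc N N) ⟩
  darboux (2 * D) (N + N) (suc (suc (l + l)))
    ≡⟨ cong (darboux (2 * D) (N + N)) (cong suc (+-suc l l)) ⟨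
  darboux (2 * D) (N + N) (suc l + suc l) ∎
  where
  open ≤-Reasoning
  term : ∀ {m} .{{_ : NonZero m}} → m ≤ suc (suc (N + N)) → D / suc N ≤ 2 * D / m
  term {m} m≤ = begin
    D / suc N               ≡⟨ m*n/m*o≡n/o 2 D (suc N) ⟨
    2 * D / (2 * suc N)     ≤⟨ /-monoʳ-≤ (2 * D) (≤-trans m≤ (≤-reflexive
                                 (solve 1 (λ n → con 2 :+ (n :+ n) := con 2 :* (con 1 :+ n)) refl N))) ⟩
    2 * D / m               ∎

-- The interval `[1 , 2 ^ suc j]` is cut at 2. The first piece gives a sum for `log 2`; the second
-- is a copy of `[1 , 2 ^ j]` scaled by 2, to which `darboux-double` applies. The factor `2 ^ j` on
-- `D` absorbs the doublings.
log-2^ : ∀ D N j → j * (2 ^ j * darboux D N N) ≤ darboux (2 ^ j * D) N ((2 ^ j ∸ 1) * N)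
log-2^ D N zero = z≤n
log-2^ D N (suc j) = begin
  (1 + j) * (2 * 2 ^ j * u)
    ≡⟨ solve 3 (λ j q u → (con 1 :+ j) :* (con 2 :* q :* u) := con 2 :* q :* u :+ con 2 :* (j :* (q :* u)))
         refl j (2 ^ j) u ⟩
  2 * 2 ^ j * u + 2 * (j * (2 ^ j * u))
    ≤⟨ +-mono-≤ (darboux-scale (2 * 2 ^ j) D N N) (*-monoʳ-≤ 2 (log-2^ D N j)) ⟩
  darboux (2 * 2 ^ j * D) N N + 2 * darboux (2 ^ j * D) N l
    ≤⟨ +-monoʳ-≤ _ (darboux-double (2 ^ j * D) N l) ⟩
  darboux (2 * 2 ^ j * D) N N + darboux (2 * (2 ^ j * D)) (N + N) (l + l)
    ≡⟨ cong (λ x → darboux (2 * 2 ^ j * D) N N + darboux x (N + N) (l + l)) (*-assoc 2 (2 ^ j) D) ⟨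
  darboux (2 * 2 ^ j * D) N N + darboux (2 * 2 ^ j * D) (N + N) (l + l)
    ≡⟨ darboux-+ (2 * 2 ^ j * D) N N (l + l) ⟨
  darboux (2 * 2 ^ j * D) N (N + (l + l))
    ≡⟨ cong (darboux (2 * 2 ^ j * D) N) length-eq ⟩
  darboux (2 * 2 ^ j * D) N ((2 * 2 ^ j ∸ 1) * N) ∎
  where
  open ≤-Reasoning
  u = darboux D N N
  l = (2 ^ j ∸ 1) * N
  length-eq : N + (l + l) ≡ (2 * 2 ^ j ∸ 1) * N
  length-eq with 2 ^ j | m^n>0 2 j
  ... | suc q | _ = solve 2 (λ q n → n :+ (q :* n :+ q :* n) := (q :+ (con 1 :+ (q :+ con 0))) :* n) refl q N

-- The number of vertices needed

^-distribʳ-* : ∀ m n k → (m * n) ^ k ≡ m ^ k * n ^ k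
^-distribʳ-* m n zero    = refl
^-distribʳ-* m n (suc k) = trans (cong (m * n *_) (^-distribʳ-* m n k))
  (solve 4 (λ a b c d → a :* b :* (c :* d) := a :* c :* (b :* d)) refl m n (m ^ k) (n ^ k))

^-cancelˡ-< : ∀ k {m n} → m ^ k < n ^ k → m < n
^-cancelˡ-< k lt = ≰⇒> λ n≤m → <⇒≱ lt (^-monoˡ-≤ k n≤m)

bernoulli-lower : ∀ x m → x ^ m * (x + m) ≤ x * suc x ^ m
bernoulli-lower x zero = ≤-reflexive (solve 1 (λ x → con 1 :* (x :+ con 0) := x :* con 1) refl x)
bernoulli-lower x (suc m) = begin
  x * x ^ m * (x + suc m)
    ≡⟨ solve 3 (λ x p m → x :* p :* (x :+ (con 1 :+ m)) := x :* (p :* (x :+ m)) :+ p :* x) refl x (x ^ m) m ⟩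
  x * (x ^ m * (x + m)) + x ^ m * x
    ≤⟨ +-monoʳ-≤ _ (*-monoʳ-≤ (x ^ m) (m≤m+n x m)) ⟩
  x * (x ^ m * (x + m)) + x ^ m * (x + m)
    ≡⟨ +-comm _ (x ^ m * (x + m)) ⟩
  suc x * (x ^ m * (x + m))
    ≤⟨ *-monoʳ-≤ (suc x) (bernoulli-lower x m) ⟩
  suc x * (x * suc x ^ m)
    ≡⟨ solve 3 (λ s x q → s :* (x :* q) := x :* (s :* q)) refl (suc x) x (suc x ^ m) ⟩
  x * (suc x * suc x ^ m) ∎
  where open ≤-Reasoning

-- Bernoulli's inequality for powers of `1 − 1/(1 + y)`, cleared of denominators.
bernoulli-upper : ∀ y m → suc y ^ suc m ≤ y ^ suc m + suc m * suc y ^ m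
bernoulli-upper y zero = ≤-reflexive (solve 1 (λ y → (con 1 :+ y) :* con 1 := y :* con 1 :+ con 1) refl y)
bernoulli-upper y (suc m) = begin
  suc y * suc y ^ suc m
    ≤⟨ *-monoʳ-≤ (suc y) (bernoulli-upper y m) ⟩
  suc y * (y ^ suc m + suc m * suc y ^ m)
    ≡⟨ solve 4 (λ y a m b → (con 1 :+ y) :* (a :+ m :* b) := y :* a :+ (a :+ m :* ((con 1 :+ y) :* b)))
         refl y (y ^ suc m) (suc m) (suc y ^ m) ⟩
  y * y ^ suc m + (y ^ suc m + suc m * suc y ^ suc m)
    ≤⟨ +-monoʳ-≤ (y * y ^ suc m) (+-monoˡ-≤ _ (^-monoˡ-≤ (suc m) (n≤1+n y))) ⟩
  y * y ^ suc m + suc (suc m) * suc y ^ suc m ∎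
  where open ≤-Reasoning

-- Passing from `r` to `x = suc r` multiplies the left side by `2 * x`, and `(1 + 1/x) ^ x ≥ 2`
-- shows that the right side grows at least as fast.
2^r*r!≤[1+r]^r : ∀ r → 2 ^ r * r ! ≤ suc r ^ r
2^r*r!≤[1+r]^r zero = ≤-refl
2^r*r!≤[1+r]^r (suc r) = begin
  2 * 2 ^ r * (x * r !)
    ≡⟨ solve 3 (λ a x b → con 2 :* a :* (x :* b) := con 2 :* x :* (a :* b)) refl (2 ^ r) x (r !) ⟩
  2 * x * (2 ^ r * r !)
    ≤⟨ *-monoʳ-≤ (2 * x) (2^r*r!≤[1+r]^r r) ⟩
  2 * x * x ^ r
    ≤⟨ *-cancelˡ-≤ x (≤-trans (≤-reflexive
         (solve 2 (λ x p → x :* (con 2 :* x :* p) := x :* p :* (x :+ x)) refl x (x ^ r)))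
         (bernoulli-lower x x)) ⟩
  suc x ^ x ∎
  where
  open ≤-Reasoning
  x = suc r

-- With `x = suc s`, dividing `1 + 1/x` by `1 + 1/s` gives `1 − 1/x²`, and Bernoulli's inequality
-- `(1 − 1/x²) ^ x ≥ 1 − 1/x` makes up for the different exponents.
[1+1/s]^s-mono : ∀ s → suc s ^ s * suc s ^ suc s ≤ s ^ s * suc (suc s) ^ suc s
[1+1/s]^s-mono zero      = s≤s z≤n
[1+1/s]^s-mono s@(suc _) = *-cancelˡ-≤ s (begin
  s * (x ^ s * x ^ suc s)
    ≡⟨ solve 3 (λ s x p → s :* (p :* (x :* p)) := s :* x :* (p :* p)) refl s x (x ^ s) ⟩
  s * x * (x ^ s * x ^ s)
    ≡⟨ cong (s * x *_) (^-distribʳ-* x x s) ⟨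
  s * x * (x * x) ^ s
    ≤⟨ +-cancelʳ-≤ (x * (x * x) ^ s) _ _ (begin
         s * x * (x * x) ^ s + x * (x * x) ^ s
           ≡⟨ solve 2 (λ s q → s :* (con 1 :+ s) :* q :+ (con 1 :+ s) :* q
                := (con 1 :+ s) :* (con 1 :+ s) :* q) refl s ((x * x) ^ s) ⟩
         (x * x) ^ suc s
           ≡⟨ cong (_^ suc s) square ⟩
         suc (s * suc x) ^ suc s
           ≤⟨ bernoulli-upper (s * suc x) s ⟩
         (s * suc x) ^ suc s + x * suc (s * suc x) ^ s
           ≡⟨ cong (λ z → (s * suc x) ^ suc s + x * z ^ s) square ⟨
         (s * suc x) ^ suc s + x * (x * x) ^ s ∎) ⟩
  (s * suc x) ^ suc s
    ≡⟨ ^-distribʳ-* s (suc x) (suc s) ⟩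
  s * s ^ s * suc x ^ suc s
    ≡⟨ *-assoc s (s ^ s) _ ⟩
  s * (s ^ s * suc x ^ suc s) ∎)
  where
  open ≤-Reasoning
  x = suc s
  square : x * x ≡ suc (s * suc x)
  square = solve 1 (λ s → (con 1 :+ s) :* (con 1 :+ s) := con 1 :+ s :* (con 2 :+ s)) refl s

-- Since `(1 + 1/s) ^ s` increases, one numerical check at `b` covers all larger `s`.
[1+1/s]^[es]-lower : ∀ a e b .{{_ : NonZero b}} → a * (b ^ b) ^ e ≤ (suc b ^ b) ^ e →
                     ∀ t → let s = t + b in a * (s ^ s) ^ e ≤ (suc s ^ s) ^ e
[1+1/s]^[es]-lower a e b base zero    = base
[1+1/s]^[es]-lower a e b base (suc t) = *-cancelˡ-≤ ((s ^ s) ^ e)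
  {{m^n≢0 (s ^ s) e {{m^n≢0 s s {{>-nonZero (m≤n⇒m≤o+n t (>-nonZero⁻¹ b))}}}}}} (begin
  (s ^ s) ^ e * (a * (x ^ x) ^ e)
    ≡⟨ solve 3 (λ a b c → a :* (b :* c) := b :* a :* c) refl ((s ^ s) ^ e) a ((x ^ x) ^ e) ⟩
  a * (s ^ s) ^ e * (x ^ x) ^ e
    ≤⟨ *-monoˡ-≤ ((x ^ x) ^ e) ([1+1/s]^[es]-lower a e b base t) ⟩
  (x ^ s) ^ e * (x ^ x) ^ e
    ≡⟨ ^-distribʳ-* (x ^ s) (x ^ x) e ⟨
  (x ^ s * x ^ x) ^ e
    ≤⟨ ^-monoˡ-≤ e ([1+1/s]^s-mono s) ⟩
  (s ^ s * suc x ^ x) ^ e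
    ≡⟨ ^-distribʳ-* (s ^ s) (suc x ^ x) e ⟩
  (s ^ s) ^ e * (suc x ^ x) ^ e ∎)
  where
  open ≤-Reasoning
  s = t + b
  x = suc s

-- The surplus factor `(1 + 1/s) ^ e` is at least 1. For `s = r − 1` the exponent is a multiple of
-- `r`, as is `M₀` in `Large`.
[1+1/s]^[e[1+s]]-lower : ∀ a e b .{{_ : NonZero b}} → a * (b ^ b) ^ e ≤ (suc b ^ b) ^ e →
                         ∀ {s} → b ≤ s → a * s ^ (e * suc s) ≤ suc s ^ (e * suc s)
[1+1/s]^[e[1+s]]-lower a e b base {s} b≤s = begin
  a * s ^ (e * suc s)
    ≡⟨ cong (a *_) (power s) ⟩
  a * ((s ^ s) ^ e * s ^ e)
    ≡⟨ *-assoc a _ _ ⟨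
  a * (s ^ s) ^ e * s ^ e
    ≤⟨ *-mono-≤ (subst (λ s → a * (s ^ s) ^ e ≤ (suc s ^ s) ^ e) (m∸n+n≡m b≤s)
                  ([1+1/s]^[es]-lower a e b base (s ∸ b)))
                (^-monoˡ-≤ e (n≤1+n s)) ⟩
  (suc s ^ s) ^ e * suc s ^ e
    ≡⟨ power (suc s) ⟨
  suc s ^ (e * suc s) ∎
  where
  open ≤-Reasoning
  power : ∀ b → b ^ (e * suc s) ≡ (b ^ s) ^ e * b ^ e
  power b = trans (cong (b ^_) (solve 2 (λ e s → e :* (con 1 :+ s) := s :* e :+ e) refl e s))
    (trans (^-distribˡ-+-* b (s * e) e) (cong (_* b ^ e) (sym (^-*-assoc b s e))))

-- r (r − 1) A(r − 2) for r = 2 + s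
ratio : ℕ → ℕ
ratio s = suc (suc s) * (suc s * arrangements s)

-- The constant 68/25 = 2.72 lies just above e. The added 1 lets the induction close; it starts at 6
-- because the inequality fails at 5.
arrangements-≤ : ∀ t → 25 * (arrangements (t + 6) + 1) ≤ 68 * (t + 6) !
arrangements-≤ zero    = toWitness {a? = 25 * (arrangements 6 + 1) ≤? 68 * 6 !} tt
arrangements-≤ (suc t) = begin
  25 * (suc j * a + 1 + 1)   ≤⟨ *-monoʳ-≤ 25 (lemma j a) ⟩
  25 * (suc j * (a + 1))     ≡⟨ swap 25 (suc j) (a + 1) ⟩
  suc j * (25 * (a + 1))     ≤⟨ *-monoʳ-≤ (suc j) (arrangements-≤ t) ⟩
  suc j * (68 * j !)         ≡⟨ swap (suc j) 68 (j !) ⟩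
  68 * (suc j * j !)         ∎
  where
  open ≤-Reasoning
  j = t + 6
  a = arrangements j
  swap : ∀ a b c → a * (b * c) ≡ b * (a * c)
  swap = solve 3 (λ a b c → a :* (b :* c) := b :* (a :* c)) refl
  lemma : ∀ j a → .{{_ : NonZero j}} → suc j * a + 1 + 1 ≤ suc j * (a + 1)
  lemma (suc i) a = begin
    suc (suc i) * a + 1 + 1             ≤⟨ m≤m+n _ i ⟩
    suc (suc i) * a + 1 + 1 + i
      ≡⟨ solve 2 (λ i a → (con 2 :+ i) :* a :+ con 1 :+ con 1 :+ i := (con 2 :+ i) :* (a :+ con 1)) refl i a ⟩
    suc (suc i) * (a + 1)               ∎
  instance
    j≢0 : NonZero j
    j≢0 = >-nonZero (m≤n⇒m≤o+n t (s≤s z≤n))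

ratio-≤ : ∀ {s} → 6 ≤ s → 25 * ratio s ≤ 68 * (suc (suc s)) !
ratio-≤ {s} 6≤s = begin
  25 * (suc (suc s) * (suc s * arrangements s))
    ≡⟨ rearrange 25 (suc (suc s)) (suc s) (arrangements s) ⟩
  suc (suc s) * (suc s * (25 * arrangements s))
    ≤⟨ *-monoʳ-≤ (suc (suc s)) (*-monoʳ-≤ (suc s) (≤-trans (*-monoʳ-≤ 25 (m≤m+n (arrangements s) 1))
         (subst (λ s → 25 * (arrangements s + 1) ≤ 68 * s !) (m∸n+n≡m 6≤s) (arrangements-≤ (s ∸ 6))))) ⟩
  suc (suc s) * (suc s * (68 * s !))
    ≡⟨ rearrange 68 (suc (suc s)) (suc s) (s !) ⟨
  68 * (suc (suc s) * (suc s * s !)) ∎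
  where
  open ≤-Reasoning
  rearrange : ∀ a b c d → a * (b * (c * d)) ≡ b * (c * (a * d))
  rearrange = solve 4 (λ a b c d → a :* (b :* (c :* d)) := b :* (c :* (a :* d))) refl

ratio>0 : ∀ s → 0 < ratio s
ratio>0 s = *-mono-≤ (s≤s (z≤n {suc s})) (*-mono-≤ (s≤s (z≤n {s})) (arrangements>0 s))
  where
  arrangements>0 : ∀ s → 0 < arrangements s
  arrangements>0 zero    = s≤s z≤n
  arrangements>0 (suc s) = m≤n+m 1 _

-- With P = ratio s and P (M − 1) + 2 ≤ n ≤ P M + 1, each vertex meets at least
-- M random choices, and at most P M vertices have to be attached.  The bound
-- P M (1 − 1/r) ^ M on the expected number of failures decreases in M ≥ r − 1,
-- so that it is enough to check it at one M₀ ≤ M.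
Threshold : ℕ → ℕ → Set
Threshold s n = ∃[ M₀ ] suc s ≤ M₀ ×
  ratio s * M₀ * suc s ^ M₀ < suc (suc s) ^ M₀ ×
  (∀ M → n ≤ ratio s * M + 1 → M₀ ≤ M)

-- The range r ≥ 64

binary-length : ∀ r → 0 < r → ∃[ j ] 2 ^ j ≤ r × r < 2 ^ suc j
binary-length (suc zero) _ = 0 , ≤-refl , ≤-refl
binary-length (suc r@(suc _)) _ with binary-length r (s≤s z≤n)
... | j , lo , hi with suc r <? 2 ^ suc j
... | yes hi′ = j , m≤n⇒m≤1+n lo , hi′
... | no ¬hi′ = suc j , hi″ , ≤-<-trans hi (^-monoʳ-< 2 ≤-refl (n<1+n (suc j)))
  where
  hi″ : 2 ^ suc j ≤ suc r
  hi″ = ≮⇒≥ ¬hi′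

-- The factor `2 ^ r` gained over `suc r ^ r` lowers the exponent from `suc j * r` to `j * r`.
!-≤-2^ : ∀ r j → r < 2 ^ suc j → r ! ≤ 2 ^ (j * r)
!-≤-2^ r j r< = *-cancelˡ-≤ (2 ^ r) {{m^n≢0 2 r}} (begin
  2 ^ r * r !           ≤⟨ 2^r*r!≤[1+r]^r r ⟩
  suc r ^ r             ≤⟨ ^-monoˡ-≤ r r< ⟩
  (2 * 2 ^ j) ^ r       ≡⟨ ^-distribʳ-* 2 (2 ^ j) r ⟩
  2 ^ r * (2 ^ j) ^ r   ≡⟨ cong (2 ^ r *_) (^-*-assoc 2 j r) ⟩
  2 ^ r * 2 ^ (j * r)   ∎)
  where open ≤-Reasoning

8*j≤2^j : ∀ t → 8 * (t + 6) ≤ 2 ^ (t + 6)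
8*j≤2^j zero    = toWitness {a? = 48 ≤? 64} tt
8*j≤2^j (suc t) = begin
  8 * suc (t + 6)                 ≡⟨ *-suc 8 (t + 6) ⟩
  8 + 8 * (t + 6)                 ≤⟨ +-mono-≤ (m≤m*n 8 (t + 6) {{>-nonZero (m≤n⇒m≤o+n t (s≤s z≤n))}}) ≤-refl ⟩
  8 * (t + 6) + 8 * (t + 6)       ≤⟨ +-mono-≤ (8*j≤2^j t) (≤-trans (8*j≤2^j t) (m≤m+n _ 0)) ⟩
  2 * 2 ^ (t + 6)                 ∎
  where open ≤-Reasoning

module Large (s j : ℕ) (64≤r : 64 ≤ suc (suc s)) (6≤j : 6 ≤ j)
             (lo : 2 ^ j ≤ suc (suc s)) (hi : suc (suc s) < 2 ^ suc j) where
  open ≤-Reasoning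

  -- As `3 * 0.68 / 2.72 = 3/4`, the bounds on `n` and `ratio s` guarantee an `M` of about
  -- `(3/4) * j * r ^ 2`. Rounding `j * r / 4` down to `q` makes `M₀` a multiple of `r`.
  r q M₀ : ℕ
  r = suc (suc s)
  q = j * r / 4
  M₀ = 3 * (r * q)

  62≤s : 62 ≤ s
  62≤s = s≤s⁻¹ (s≤s⁻¹ 64≤r)

  4q≤jr : 4 * q ≤ j * r
  4q≤jr = ≤-trans (≤-reflexive (*-comm 4 q)) (m/n*n≤m (j * r) 4)

  jr≤4q+3 : j * r ≤ 4 * q + 3
  jr≤4q+3 = begin
    j * r              ≡⟨ m≡m%n+[m/n]*n (j * r) 4 ⟩
    j * r % 4 + q * 4  ≤⟨ +-monoˡ-≤ _ (s≤s⁻¹ (m%n<n (j * r) 4)) ⟩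
    3 + q * 4          ≡⟨ trans (+-comm 3 _) (cong (_+ 3) (*-comm q 4)) ⟩
    4 * q + 3          ∎

  -- From `r ≥ 64`, `q` is at least `16 * j`. This pays for the step from 16 to 17 in `exponent`.
  12j+16≤q : 12 * j + 16 ≤ q
  12j+16≤q = begin
    12 * j + 16        ≤⟨ +-monoʳ-≤ (12 * j) (≤-trans (m≤m+n 16 8) (*-monoʳ-≤ 4 6≤j)) ⟩
    12 * j + 4 * j     ≡⟨ solve 1 (λ j → con 12 :* j :+ con 4 :* j := j :* con 16) refl j ⟩
    j * 16             ≡⟨ m*n/n≡m (j * 16) 4 ⟨
    j * 16 * 4 / 4     ≤⟨ /-monoˡ-≤ 4 (≤-trans (≤-reflexive (*-assoc j 16 4)) (*-monoʳ-≤ j 64≤r)) ⟩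
    q                  ∎

  1≤q : 1 ≤ q
  1≤q = ≤-trans (≤-trans (s≤s z≤n) (m≤n+m 16 (12 * j))) 12j+16≤q

  s<M₀ : suc s ≤ M₀
  s<M₀ = begin
    suc s        ≤⟨ n≤1+n _ ⟩
    r            ≤⟨ m≤m*n r q {{>-nonZero 1≤q}} ⟩
    r * q        ≤⟨ m≤n*m (r * q) 3 ⟩
    M₀           ∎

  P≤3r! : ratio s ≤ 3 * r !
  P≤3r! = *-cancelˡ-≤ 25 (begin
    25 * ratio s    ≤⟨ ratio-≤ (≤-trans (m≤m+n 6 56) 62≤s) ⟩
    68 * r !        ≤⟨ *-monoˡ-≤ (r !) (m≤m+n 68 7) ⟩
    75 * r !        ≡⟨ *-assoc 25 3 (r !) ⟩
    25 * (3 * r !)  ∎)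

  -- The bounds `r ! ≤ 2 ^ (j * r)`, `8 * j ≤ 2 ^ j` and `r < 2 ^ suc j` leave a constant 9/8, below
  -- the 2 that the exponent allows. The factor 32 clears denominators.
  PM₀-bound : ratio s * M₀ < 2 ^ (j * r + (3 * j + 1))
  PM₀-bound = *-cancelˡ-< 32 _ _ (begin-strict
    32 * (ratio s * (3 * (r * q)))
      ≤⟨ *-monoʳ-≤ 32 (*-monoˡ-≤ (3 * (r * q)) P≤3r!) ⟩
    32 * (3 * r ! * (3 * (r * q)))
      ≡⟨ solve 3 (λ f r q → con 32 :* (con 3 :* f :* (con 3 :* (r :* q)))
                         := con 72 :* (f :* (r :* (con 4 :* q)))) refl (r !) r q ⟩
    72 * (r ! * (r * (4 * q)))
      ≤⟨ *-monoʳ-≤ 72 (*-monoʳ-≤ (r !) (*-monoʳ-≤ r 4q≤jr)) ⟩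
    72 * (r ! * (r * (j * r)))
      ≡⟨ solve 3 (λ f r j → con 72 :* (f :* (r :* (j :* r)))
                         := con 9 :* (f :* ((con 8 :* j) :* (r :* r)))) refl (r !) r j ⟩
    9 * (r ! * (8 * j * (r * r)))
      ≤⟨ *-monoʳ-≤ 9 (*-mono-≤ (!-≤-2^ r j hi)
           (*-mono-≤ (subst (λ j → 8 * j ≤ 2 ^ j) (m∸n+n≡m 6≤j) (8*j≤2^j (j ∸ 6)))
                     (*-mono-≤ (<⇒≤ hi) (<⇒≤ hi)))) ⟩
    9 * (2 ^ (j * r) * (2 ^ j * (2 * 2 ^ j * (2 * 2 ^ j))))
      ≡⟨ solve 2 (λ a b → con 9 :* (a :* (b :* ((con 2 :* b) :* (con 2 :* b))))
                       := con 36 :* (a :* (b :* (b :* b)))) refl (2 ^ (j * r)) (2 ^ j) ⟩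
    36 * x
      <⟨ *-monoˡ-< x {{m*n≢0 _ _ {{m^n≢0 2 (j * r)}} {{m*n≢0 _ _ {{m^n≢0 2 j}} {{m*n≢0 _ _ {{m^n≢0 2 j}} {{m^n≢0 2 j}}}}}}}} (m≤m+n 37 27) ⟩
    64 * x
      ≡⟨ solve 2 (λ a b → con 64 :* (a :* (b :* (b :* b)))
                       := con 32 :* (a :* ((b :* (b :* (b :* con 1))) :* con 2))) refl (2 ^ (j * r)) (2 ^ j) ⟩
    32 * (2 ^ (j * r) * ((2 ^ j) ^ 3 * 2))
      ≡⟨ cong (32 *_) power ⟨
    32 * 2 ^ (j * r + (3 * j + 1)) ∎)
    where
    x = 2 ^ (j * r) * (2 ^ j * (2 ^ j * 2 ^ j))
    power : 2 ^ (j * r + (3 * j + 1)) ≡ 2 ^ (j * r) * ((2 ^ j) ^ 3 * 2)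
    power = trans (^-distribˡ-+-* 2 (j * r) _) (cong (2 ^ (j * r) *_)
      (trans (^-distribˡ-+-* 2 (3 * j) 1) (cong (_* 2)
        (trans (cong (2 ^_) (*-comm 3 j)) (sym (^-*-assoc 2 j 3))))))

  exponent : (j * r + (3 * j + 1)) * 4 ≤ 17 * q
  exponent = begin
    (j * r + (3 * j + 1)) * 4
      ≤⟨ *-monoˡ-≤ 4 (+-monoˡ-≤ (3 * j + 1) jr≤4q+3) ⟩
    (4 * q + 3 + (3 * j + 1)) * 4
      ≡⟨ solve 2 (λ q j → (con 4 :* q :+ con 3 :+ (con 3 :* j :+ con 1)) :* con 4
                       := con 16 :* q :+ (con 12 :* j :+ con 16)) refl q j ⟩
    16 * q + (12 * j + 16)
      ≤⟨ +-monoʳ-≤ (16 * q) 12j+16≤q ⟩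
    16 * q + q
      ≡⟨ +-comm (16 * q) q ⟩
    17 * q ∎

  -- In fourth powers the exponent `4 * M₀ = 12 * r * q` consists of `q` blocks of length `12 * r`,
  -- each worth a factor `2 ^ 17`, while `exponent` keeps `(ratio s * M₀) ^ 4` below `2 ^ (17 * q)`.
  covered : ∀ a → a ≡ 2 ^ 17 → a * suc s ^ (12 * r) ≤ r ^ (12 * r) →
            ratio s * M₀ * suc s ^ M₀ < r ^ M₀
  covered a a≡ base = ^-cancelˡ-< 4 (begin-strict
    (ratio s * M₀ * suc s ^ M₀) ^ 4
      ≡⟨ ^-distribʳ-* (ratio s * M₀) (suc s ^ M₀) 4 ⟩
    (ratio s * M₀) ^ 4 * (suc s ^ M₀) ^ 4
      <⟨ *-monoˡ-< ((suc s ^ M₀) ^ 4) {{m^n≢0 (suc s ^ M₀) 4 {{m^n≢0 (suc s) M₀}}}} (begin-strict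
           (ratio s * M₀) ^ 4
             <⟨ ^-monoˡ-< 4 PM₀-bound ⟩
           (2 ^ (j * r + (3 * j + 1))) ^ 4
             ≡⟨ ^-*-assoc 2 (j * r + (3 * j + 1)) 4 ⟩
           2 ^ ((j * r + (3 * j + 1)) * 4)
             ≤⟨ ^-monoʳ-≤ 2 exponent ⟩
           2 ^ (17 * q)
             ≡⟨ ^-*-assoc 2 17 q ⟨
           (2 ^ 17) ^ q
             ≡⟨ cong (_^ q) a≡ ⟨
           a ^ q ∎) ⟩
    a ^ q * (suc s ^ M₀) ^ 4
      ≡⟨ cong (a ^ q *_) (power (suc s)) ⟩
    a ^ q * (suc s ^ (12 * r)) ^ q
      ≡⟨ ^-distribʳ-* a _ q ⟨
    (a * suc s ^ (12 * r)) ^ q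
      ≤⟨ ^-monoˡ-≤ q base ⟩
    (r ^ (12 * r)) ^ q
      ≡⟨ power r ⟨
    (r ^ M₀) ^ 4 ∎)
    where
    power : ∀ b → (b ^ M₀) ^ 4 ≡ (b ^ (12 * r)) ^ q
    power b = trans (^-*-assoc b M₀ 4) (trans (cong (b ^_)
      (solve 2 (λ r q → con 3 :* (r :* q) :* con 4 := con 12 :* r :* q) refl r q))
      (sym (^-*-assoc b (12 * r) q)))

  -- If `M < M₀`, then `n ≤ ratio s * M₀`, which is at most `2.72 * r !` times `(3/4) * j * r ^ 2`.
  -- The lower bound on `n` contradicts this once `u / D > 0.68`, which is what `gap` says.
  reached : ∀ {n D u} → 68 * (3 * D) < 25 * (4 * (3 * u)) →
            3 * r ^ 2 * r ! * (j * u) ≤ D * n →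
            ∀ M → n ≤ ratio s * M + 1 → M₀ ≤ M
  reached {n} {D} {u} gap hyp M n≤ = ≮⇒≥ λ M<M₀ → <⇒≱ gap
    (*-cancelˡ-≤ w {{w≢0}} (begin
      w * (25 * (4 * (3 * u)))
        ≡⟨ rearrange₁ (r !) r j u 25 4 ⟩
      25 * (4 * (3 * r ^ 2 * r ! * (j * u)))
        ≤⟨ *-monoʳ-≤ 25 (*-monoʳ-≤ 4 (≤-trans hyp (*-monoʳ-≤ D (n≤PM₀ M<M₀)))) ⟩
      25 * (4 * (D * (ratio s * (3 * (r * q)))))
        ≡⟨ rearrange₂ 25 4 D (ratio s) r q ⟩
      25 * ratio s * (D * (3 * (r * (4 * q))))
        ≤⟨ *-mono-≤ (ratio-≤ (≤-trans (m≤m+n 6 56) 62≤s))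
             (*-monoʳ-≤ D (*-monoʳ-≤ 3 (*-monoʳ-≤ r 4q≤jr))) ⟩
      68 * r ! * (D * (3 * (r * (j * r))))
        ≡⟨ rearrange₃ 68 (r !) D r j ⟩
      w * (68 * (3 * D)) ∎))
    where
    w = r ! * (r * (j * r))

    w≢0 : NonZero w
    w≢0 = m*n≢0 (r !) _ {{r !≢0}} {{m*n≢0 r (j * r) {{_}} {{m*n≢0 j r {{>-nonZero (≤-trans (s≤s z≤n) 6≤j)}}}}}}

    n≤PM₀ : M < M₀ → n ≤ ratio s * M₀
    n≤PM₀ M<M₀ = begin
      n                    ≤⟨ n≤ ⟩
      ratio s * M + 1      ≤⟨ +-monoʳ-≤ (ratio s * M) (ratio>0 s) ⟩
      ratio s * M + ratio s ≡⟨ trans (+-comm _ (ratio s)) (sym (*-suc (ratio s) M)) ⟩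
      ratio s * suc M      ≤⟨ *-monoʳ-≤ (ratio s) M<M₀ ⟩
      ratio s * M₀         ∎

    rearrange₁ : ∀ f r j u a b → f * (r * (j * r)) * (a * (b * (3 * u))) ≡
                                 a * (b * (3 * r ^ 2 * f * (j * u)))
    rearrange₁ = solve 6 (λ f r j u a b → f :* (r :* (j :* r)) :* (a :* (b :* (con 3 :* u)))
      := a :* (b :* (con 3 :* (r :* (r :* con 1)) :* f :* (j :* u)))) refl

    rearrange₂ : ∀ a b D P r q → a * (b * (D * (P * (3 * (r * q))))) ≡ a * P * (D * (3 * (r * (b * q))))
    rearrange₂ = solve 6 (λ a b D P r q → a :* (b :* (D :* (P :* (con 3 :* (r :* q)))))
      := a :* P :* (D :* (con 3 :* (r :* (b :* q))))) refl

    rearrange₃ : ∀ a f D r j → a * f * (D * (3 * (r * (j * r)))) ≡ f * (r * (j * r)) * (a * (3 * D))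
    rearrange₃ = solve 5 (λ a f D r j → a :* f :* (D :* (con 3 :* (r :* (j :* r))))
      := f :* (r :* (j :* r)) :* (a :* (con 3 :* D))) refl

log-2^-bound : ∀ c r n → c ·ᴿ log r ≤ᴿ fromℕᴿ n → ∀ k D j → 2 ^ j ≤ r →
               c * (j * darboux D (suc k) (suc k)) ≤ D * n
log-2^-bound c r n hyp k D j lo = *-cancelˡ-≤ (2 ^ j) {{m^n≢0 2 j}} (begin
  2 ^ j * (c * (j * u))
    ≡⟨ solve 4 (λ q c j u → q :* (c :* (j :* u)) := c :* (j :* (q :* u))) refl (2 ^ j) c j u ⟩
  c * (j * (2 ^ j * u))
    ≤⟨ *-monoʳ-≤ c (≤-trans (log-2^ D (suc k) j)
         (darboux-mono (2 ^ j * D) (suc k) (*-monoˡ-≤ (suc k) (∸-monoˡ-≤ 1 lo)))) ⟩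
  c * darboux (2 ^ j * D) (suc k) ((r ∸ 1) * suc k)
    ≤⟨ darboux-bound c r n hyp k (2 ^ j * D) ⟩
  2 ^ j * D * n
    ≡⟨ *-assoc (2 ^ j) D n ⟩
  2 ^ j * (D * n) ∎)
  where
  open ≤-Reasoning
  u = darboux D (suc k) (suc k)

threshold-large : ∀ s n → 64 ≤ suc (suc s) →
  (3 * suc (suc s) ^ 2 * suc (suc s) !) ·ᴿ log (suc (suc s)) ≤ᴿ fromℕᴿ n →
  Threshold s n
threshold-large s n 64≤r hyp with binary-length (suc (suc s)) (s≤s z≤n)
... | j , lo , hi = M₀ , s<M₀
  -- 2 ^ 17 < e ^ 12
  , covered (2 ^ 17) refl ([1+1/s]^[e[1+s]]-lower (2 ^ 17) 12 63
      (toWitness {a? = 2 ^ 17 * (63 ^ 63) ^ 12 ≤? (64 ^ 63) ^ 12} tt) (s≤s⁻¹ 64≤r))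
  -- The lower sum for `log 2` with steps of length 1/20 exceeds 0.68.
  , reached {D = 1000000} (toWitness {a? = 68 * (3 * 1000000) <? 25 * (4 * (3 * darboux 1000000 20 20))} tt)
      (log-2^-bound (3 * suc (suc s) ^ 2 * suc (suc s) !) (suc (suc s)) n hyp 19 1000000 j lo)
  where
  6≤j : 6 ≤ j
  6≤j = ≮⇒≥ λ j<6 → <⇒≱ hi (≤-trans (^-monoʳ-≤ 2 j<6) 64≤r)
  open Large s j 64≤r 6≤j lo hi

-- The range r < 64

-- sample s / 1000000 is at most c log (2 + s), for the c of the theorem.
sample : ℕ → ℕ
sample s = 3 * suc (suc s) ^ 2 * suc (suc s) ! * darboux 1000000 10 (suc s * 10)

sample-≤ : ∀ s n → (3 * suc (suc s) ^ 2 * suc (suc s) !) ·ᴿ log (suc (suc s)) ≤ᴿ fromℕᴿ n →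
           sample s ≤ 1000000 * n
sample-≤ s n hyp = darboux-bound (3 * suc (suc s) ^ 2 * suc (suc s) !) (suc (suc s)) n hyp 9 1000000

-- As ratio s * pred M₀ ≤ sample s / 1000000 ∸ 2, the last condition of
-- Certified holds for this M₀.
sample-threshold : ℕ → ℕ
sample-threshold s =
  suc (_/_ (sample s / 1000000 ∸ 2) (ratio s) {{>-nonZero (ratio>0 s)}})

Certified : ℕ → ℕ → ℕ → Set
Certified s b M₀ = suc s ≤ M₀ × ratio s * M₀ * suc s ^ M₀ < suc (suc s) ^ M₀ ×
  1000000 * (ratio s * pred M₀ + 1) < b

certified? : ∀ s b M₀ → Dec (Certified s b M₀)
certified? s b M₀ = suc s ≤? M₀ ×-dec ratio s * M₀ * suc s ^ M₀ <? suc (suc s) ^ M₀ ×-dec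
  1000000 * (ratio s * pred M₀ + 1) <? b

abstract
  certified : ∀ {s} → s < 62 → Certified s (sample s) (sample-threshold s)
  certified = toWitness
    {a? = allUpTo? (λ s → certified? s (sample s) (sample-threshold s)) 62} tt

lower-bound⇒≤ : ∀ D P b n M₀ → D * (P * pred M₀ + 1) < b → b ≤ D * n →
               ∀ M → n ≤ P * M + 1 → M₀ ≤ M
lower-bound⇒≤ D P b n M₀ short b≤Dn M n≤ = ≮⇒≥ λ M<M₀ → <⇒≱ short (begin
  b                          ≤⟨ b≤Dn ⟩
  D * n                      ≤⟨ *-monoʳ-≤ D (≤-trans n≤
                                  (+-monoˡ-≤ 1 (*-monoʳ-≤ P (<⇒≤pred M<M₀)))) ⟩
  D * (P * pred M₀ + 1)      ∎)
  where open ≤-Reasoning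

certified⇒threshold : ∀ s b n M₀ → Certified s b M₀ → b ≤ 1000000 * n → Threshold s n
certified⇒threshold s b n M₀ (s<M₀ , union , short) b≤ =
  M₀ , s<M₀ , union , lower-bound⇒≤ 1000000 (ratio s) b n M₀ short b≤

threshold-small : ∀ s n → s < 62 →
  (3 * suc (suc s) ^ 2 * suc (suc s) !) ·ᴿ log (suc (suc s)) ≤ᴿ fromℕᴿ n →
  Threshold s n
threshold-small s n s<62 hyp =
  certified⇒threshold s (sample s) n (sample-threshold s) (certified s<62) (sample-≤ s n hyp)

threshold : ∀ s n →
  (3 * suc (suc s) ^ 2 * suc (suc s) !) ·ᴿ log (suc (suc s)) ≤ᴿ fromℕᴿ n →
  Threshold s n
threshold s n hyp with s <? 62
... | yes s<62 = threshold-small s n s<62 hyp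
... | no s≮62  = threshold-large s n (s≤s (s≤s (≮⇒≥ s≮62))) hyp

-- x ((s − 1) / s) ^ x, here with s for s − 1, is decreasing from x = s − 1 on.
x*s^x-mono : ∀ P s {M₀ M} → s ≤ M₀ → M₀ ≤′ M →
             P * M₀ * s ^ M₀ < suc s ^ M₀ → P * M * s ^ M < suc s ^ M
x*s^x-mono P s s≤M₀ ≤′-refl lt = lt
x*s^x-mono P s s≤M₀ (≤′-step {M} M₀≤M) lt = begin-strict
  P * suc M * (s * s ^ M)
    ≡⟨ solve 4 (λ P M s q → P :* (con 1 :+ M) :* (s :* q) := P :* (s :+ M :* s) :* q) refl P M s (s ^ M) ⟩
  P * (s + M * s) * s ^ M
    -- From `s ≤ M` follows `(M + 1) * s ≤ M * (s + 1)`, which makes the decrease start.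
    ≤⟨ *-monoˡ-≤ (s ^ M) (*-monoʳ-≤ P (+-monoˡ-≤ (M * s) (≤-trans s≤M₀ (≤′⇒≤ M₀≤M)))) ⟩
  P * (M + M * s) * s ^ M
    ≡⟨ solve 4 (λ P M s q → P :* (M :+ M :* s) :* q := (con 1 :+ s) :* (P :* M :* q)) refl P M s (s ^ M) ⟩
  suc s * (P * M * s ^ M)
    <⟨ *-monoʳ-< (suc s) (x*s^x-mono P s s≤M₀ M₀≤M lt) ⟩
  suc s * suc s ^ M ∎
  where open ≤-Reasoning

-- As `i / (1 + i)` increases with `i`, the stage with all `r` roots, where `i = r − 1`, is the
-- hardest.
*-^-antimono-< : ∀ x M {i s} → i ≤ s → x * s ^ M < suc s ^ M → x * i ^ M < suc i ^ M
*-^-antimono-< x M {i} {s} i≤s lt = *-cancelʳ-< (suc s ^ M) _ _ (begin-strict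
  x * i ^ M * suc s ^ M       ≡⟨ *-assoc x _ _ ⟩
  x * (i ^ M * suc s ^ M)     ≡⟨ cong (x *_) (^-distribʳ-* i (suc s) M) ⟨
  x * (i * suc s) ^ M         ≤⟨ *-monoʳ-≤ x (^-monoˡ-≤ M (begin
                                   i * suc s   ≡⟨ *-suc i s ⟩
                                   i + i * s   ≤⟨ +-monoˡ-≤ (i * s) i≤s ⟩
                                   suc i * s   ∎)) ⟩
  x * (suc i * s) ^ M         ≡⟨ cong (x *_) (^-distribʳ-* (suc i) s M) ⟩
  x * (suc i ^ M * s ^ M)     ≡⟨ solve 3 (λ x a b → x :* (a :* b) := a :* (x :* b)) refl x (suc i ^ M) (s ^ M) ⟩
  suc i ^ M * (x * s ^ M)     <⟨ *-monoʳ-< (suc i ^ M) {{m^n≢0 (suc i) M}} lt ⟩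
  suc i ^ M * suc s ^ M       ∎)
  where open ≤-Reasoning

tree-partitionable : ∀ s n → Threshold s n → TreePartitionable (suc (suc s)) (K n) (suc (suc s))
-- With fewer than two vertices, `reached` at `M = 0` would force `M₀ ≤ 0`.
tree-partitionable s zero (M₀ , s<M₀ , _ , reached) c =
  contradiction (≤-trans s<M₀ (reached 0 z≤n)) λ ()
tree-partitionable s (suc zero) (M₀ , s<M₀ , _ , reached) c =
  contradiction (≤-trans s<M₀ (reached 0 (m≤n+m 1 (ratio s * 0)))) λ ()
tree-partitionable s (suc (suc n)) (M₀ , s<M₀ , union , reached) c =
  Partition.treePartition c m refl (s≤s Pm≤n) λ {i} i≤r′ →
    *-^-antimono-< (suc n) (suc m) i≤r′ (≤-<-trans
      (*-monoˡ-≤ (suc s ^ suc m) 1+n≤PM)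
      (x*s^x-mono P (suc s) s<M₀ (≤⇒≤′ (reached (suc m) 2+n≤PM+1)) union))
  where
  open ≤-Reasoning
  P = ratio s
  instance
    P≢0 : NonZero P
    P≢0 = >-nonZero (ratio>0 s)
  -- The largest `m` with `P * m + 2` at most the number `suc (suc n)` of vertices: one vertex is
  -- the first root, and the inequality for the others is strict.
  m = n / P

  Pm≤n : suc (suc s) * (suc s * (m * arrangements s)) ≤ n
  Pm≤n = ≤-trans (≤-reflexive
    (solve 4 (λ a b m c → a :* (b :* (m :* c)) := m :* (a :* (b :* c))) refl (suc (suc s)) (suc s) m (arrangements s)))
    (m/n*n≤m n P)

  1+n≤PM : suc n ≤ P * suc m
  1+n≤PM = begin
    suc n                  ≡⟨ cong suc (m≡m%n+[m/n]*n n P) ⟩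
    suc (n % P) + m * P    ≤⟨ +-monoˡ-≤ (m * P) (m%n<n n P) ⟩
    suc m * P              ≡⟨ *-comm (suc m) P ⟩
    P * suc m              ∎

  2+n≤PM+1 : suc (suc n) ≤ P * suc m + 1
  2+n≤PM+1 = ≤-trans (s≤s 1+n≤PM) (≤-reflexive (+-comm 1 (P * suc m)))

theorem1p5 : (r n : ℕ) → 2 ≤ r →
    (3 * r ^ 2 * r !) ·ᴿ log r ≤ᴿ fromℕᴿ n →
    tp r (K n) ≤ r
theorem1p5 r@(suc (suc s)) n (s≤s (s≤s z≤n)) hyp =
  proj₂ (tp-isMinimum r (K n)) r (tree-partitionable s n (threshold s n hyp))
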